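{- The first-order theory of the structure $\langle\mathbb{Q},\cdot,\leqslant\rangle$ is decidable; that is, there is an algorithm which, given a first-order sentence in the language $\{\cdot,\leqslant\}$, decides whether it is true in $\langle\mathbb{Q},\cdot,\leqslant\rangle$.
   Context: $\langle\mathbb{Q},\cdot,\leqslant\rangle$ is the first-order structure whose domain is the set of all rational numbers, with the usual multiplication and the usual (non-strict) order. -}

module Defs where

open import Data.Fin using (Fin)
open import Data.Nat using (ℕ; suc)
open import Data.Product using (Σ-syntax; _×_)
open import Data.Rational using (ℚ; _*_; _≤_)
open import Data.Sum using (_⊎_)
open import Data.Vec using (Vec; []; _∷_; lookup)
open import Relation.Binary.PropositionalEquality using (_≡_)
open import Relation.Nullary using (¬_)

infixl 7 _·_
infix  6 _≈_ _≼_
infix  5 ∼_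
infixr 4 _∧_
infixr 3 _∨_
infixr 2 _⇒_

-- First-order logic with equality over the language {·, ≤}, with de Bruijn
-- indices: the n free variables of a term or formula are the elements of
-- Fin n, and a quantifier binds index zero.

data Term (n : ℕ) : Set where
  var : Fin n → Term n
  _·_ : Term n → Term n → Term n

data Formula (n : ℕ) : Set where
  _≈_ _≼_     : Term n → Term n → Formula n
  ∼_          : Formula n → Formula n
  _∧_ _∨_ _⇒_ : Formula n → Formula n → Formula n
  all ex      : Formula (suc n) → Formula n

Sentence : Set
Sentence = Formula 0

⟦_⟧ : ∀ {n} → Term n → Vec ℚ n → ℚ
⟦ var i ⟧ ρ = lookup ρ i
⟦ s · t ⟧ ρ = ⟦ s ⟧ ρ * ⟦ t ⟧ ρ

-- Tarskian satisfaction in ⟨ℚ, ·, ≤⟩, with the metalanguage connectives read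
-- constructively.  If satisfaction is decidable for all formulas and all
-- valuations, this agrees with the classical reading.

_⊨_ : ∀ {n} → Vec ℚ n → Formula n → Set
ρ ⊨ (s ≈ t) = ⟦ s ⟧ ρ ≡ ⟦ t ⟧ ρ
ρ ⊨ (s ≼ t) = ⟦ s ⟧ ρ ≤ ⟦ t ⟧ ρ
ρ ⊨ (∼ φ)   = ¬ (ρ ⊨ φ)
ρ ⊨ (φ ∧ ψ) = (ρ ⊨ φ) × (ρ ⊨ ψ)
ρ ⊨ (φ ∨ ψ) = (ρ ⊨ φ) ⊎ (ρ ⊨ ψ)
ρ ⊨ (φ ⇒ ψ) = ρ ⊨ φ → ρ ⊨ ψ
ρ ⊨ all φ   = (q : ℚ) → (q ∷ ρ) ⊨ φ
ρ ⊨ ex φ    = Σ[ q ∈ ℚ ] (q ∷ ρ) ⊨ φ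

-- The first-order theory of ⟨ℚ, ·, ≤⟩, as a predicate on sentences.  An
-- axiom-free inhabitant of Decidable Theory is a computable function on
-- sentences whose answer is certified to be their truth value.

Theory : Sentence → Set
Theory φ = [] ⊨ φ

{-# OPTIONS --safe #-}
module Submission where

-- The positive rationals form an ordered abelian group G, written additively below, which is
-- dense modulo every m G, has decidable divisibility, and has elements of exact order m modulo
-- m G together with any finite set (a new prime).  Two tuples ρ and σ in G are (N, M)-equivalent
-- when the same integer combinations with coefficients up to N are positive and the same integer
-- combinations are divisible by M.  For each (N, M) there is an (N′, M′) such that every
-- σ has a finite list of elements realising, up to (N, M)-equivalence, every extension
-- of every tuple (N′, M′)-equivalent to σ: an extension q is either a root of a combination of ρ
-- or is described by the coset of M G relative to ρ and the cut in which L q lies, where L = N!.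
-- A formula is therefore invariant under some (N, M)-equivalence, where signs are kept apart, and
-- its quantifiers may be restricted to finite lists.

-- The obstacle is that G / mG is infinite for m > 1, so the coset of an extension `q` cannot be
-- enumerated outright. Only its position relative to ρ can: the least d > 0 for which d q is
-- congruent modulo M to some b ρ, where d ∣ M and b matters modulo M. This determines every
-- congruence on q because d is minimal, and minimality is what new primes are for: a root y of d y
-- = b σ may satisfy smaller relations, and adding (M / d) z with z generic over y and σ destroys
-- them. The order can be met afterwards, since adding a multiple of M changes no congruence modulo
-- M and such multiples are dense. With L = N! every coefficient 0 < e ≤ N divides L, so the signs
-- of all combinations e q + a ρ are read off from one position of L q. The list serves all ρ
-- equivalent to σ at once: ρ = σ gives decidability of a quantifier, arbitrary ρ its invariance.

open import Algebra.Bundles using (AbelianGroup)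
import Algebra.Properties.AbelianGroup as AbelianGroupProperties
import Algebra.Properties.CommutativeMonoid.Mult as CommutativeMonoidMult
import Algebra.Properties.Group as GroupProperties
open import Data.Fin.Base using (Fin; zero; suc)
open import Data.Integer.Base as ℤ using (ℤ; +_; -[1+_]; 0ℤ; 1ℤ; -1ℤ; ∣_∣)
open import Data.Integer.Divisibility.Signed as ℤ using (divides)
import Data.Integer.DivMod as ℤ
import Data.Integer.Properties as ℤ
import Data.Integer.Solver as ℤ-Solver
open import Data.List.Base as List
  using (List; []; _∷_; _++_; cartesianProduct; cartesianProductWith; concatMap; upTo)
open import Data.List.Membership.Propositional using (_∈_; find; lose)
open import Data.List.Membership.Propositional.Properties
  using ( ∈-++⁺ˡ; ∈-++⁺ʳ; ∈-++⁻; ∈-map⁺; ∈-map⁻; ∈-upTo⁺; ∈-upTo⁻; ∈-concatMap⁺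
        ; ∈-cartesianProduct⁺; ∈-cartesianProductWith⁺; ∈-cartesianProductWith⁻ )
open import Data.List.Relation.Unary.All as All using (All; []; _∷_)
import Data.List.Relation.Unary.All.Properties as All
open import Data.List.Relation.Unary.Any as Any using (Any; here; there)
open import Data.Nat.Base as ℕ
  using (ℕ; zero; suc; _≤_; _<_; z≤n; s≤s; z<s; NonZero; _!; _^_)
open import Data.Nat.Coprimality as ℕ using (Coprime)
import Data.Nat.Divisibility as ℕ
import Data.Nat.DivMod as ℕ
import Data.Nat.GCD as ℕ
open import Data.Nat.Induction using (<-rec)
open import Data.Nat.Primality using (Prime; euclidsLemma; prime⇒nonTrivial; prime⇒nonZero)
open import Data.Nat.Primality.Factorisation using (factorise)
import Data.Nat.Properties as ℕ
open import Data.Nat.Tactic.RingSolver using (solve-∀)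
open import Data.Product.Base using (Σ-syntax; ∃; ∃-syntax; _×_; _,_; proj₁; proj₂)
open import Data.Rational.Base as ℚ using (ℚ; 0ℚ)
import Data.Rational.Properties as ℚ
import Data.Rational.Unnormalised.Base as ℚᵘ
import Data.Rational.Unnormalised.Properties as ℚᵘ
open import Data.Sum.Base as Sum using (_⊎_; inj₁; inj₂)
open import Data.Vec.Base using (Vec; []; _∷_; lookup; map; replicate; zipWith)
import Data.Vec.Properties as Vec
open import Data.Vec.Relation.Unary.All as VecAll using ([]; _∷_)
open import Function.Base using (_∘_; it)
open import Level using (0ℓ)
open import Relation.Binary.Definitions using (tri<; tri≈; tri>)
open import Relation.Binary.PropositionalEquality
  using (_≡_; refl; sym; trans; cong; cong₂; subst; subst₂; module ≡-Reasoning)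
import Relation.Binary.Reasoning.Setoid as SetoidReasoning
open import Relation.Nullary
  using (¬_; Dec; yes; no; ¬?; _×-dec_; _⊎-dec_; _→-dec_; contradiction; map′)
open import Relation.Unary using (Decidable)

-- Abelian groups as ℤ-modules, with a solver for linear identities.

module ℤ-Module (𝔾 : AbelianGroup 0ℓ 0ℓ) where

  open AbelianGroup 𝔾 public
    using (_≈_; setoid)
    renaming ( Carrier to G; _∙_ to infixl 6 _+_; ε to 0#; _⁻¹ to infix 8 -_
             ; refl to ≈-refl; sym to ≈-sym; trans to ≈-trans; reflexive to ≈-reflexive
             ; ∙-cong to +-cong; ∙-congˡ to +-congˡ; ∙-congʳ to +-congʳ
             ; assoc to +-assoc; comm to +-comm
             ; identityˡ to +-identityˡ; identityʳ to +-identityʳ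
             ; inverseˡ to -‿inverseˡ; inverseʳ to -‿inverseʳ; ⁻¹-cong to -‿cong )
  open AbelianGroupProperties 𝔾
    renaming (⁻¹-∙-comm to -‿+-comm; ε⁻¹≈ε to -0≈0; ⁻¹-involutive to -‿involutive)
  open CommutativeMonoidMult (AbelianGroup.commutativeMonoid 𝔾)
    using (×-homo-+; ×-distrib-+; ×-congʳ) renaming (_×_ to _⋆_)
  open SetoidReasoning setoid

  infixr 7 _•_

  _•_ : ℤ → G → G
  (+ n)    • x = n ⋆ x
  -[1+ n ] • x = - (suc n ⋆ x)

  •-congˡ : ∀ i {x y} → x ≈ y → i • x ≈ i • y
  •-congˡ (+ n)    x≈y = ×-congʳ n x≈y
  •-congˡ -[1+ n ] x≈y = -‿cong (×-congʳ (suc n) x≈y)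

  •-congʳ : ∀ {i j} x → i ≡ j → i • x ≈ j • x
  •-congʳ x refl = ≈-refl

  +-cancel-outer : ∀ x y → y ≈ x + (- x + y)
  +-cancel-outer x y = ≈-sym (≈-trans (≈-sym (+-assoc _ _ _))
    (≈-trans (+-congʳ (-‿inverseʳ x)) (+-identityˡ y)))

  ⊖-• : ∀ m n x → (m ℤ.⊖ n) • x ≈ m ⋆ x + - (n ⋆ x)
  ⊖-• m zero x = ≈-sym (≈-trans (+-congˡ -0≈0) (+-identityʳ _))
  ⊖-• zero (suc n) x = ≈-sym (+-identityˡ _)
  ⊖-• (suc m) (suc n) x = begin
    (suc m ℤ.⊖ suc n) • x              ≈⟨ •-congʳ x (ℤ.[1+m]⊖[1+n]≡m⊖n m n) ⟩
    (m ℤ.⊖ n) • x                      ≈⟨ ⊖-• m n x ⟩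
    m ⋆ x + - (n ⋆ x)                  ≈⟨ +-congˡ (+-cancel-outer x _) ⟩
    m ⋆ x + (x + (- x + - (n ⋆ x)))    ≈⟨ +-congˡ (+-congˡ (-‿+-comm x _)) ⟩
    m ⋆ x + (x + - (suc n ⋆ x))        ≈⟨ +-assoc _ _ _ ⟨
    (m ⋆ x + x) + - (suc n ⋆ x)        ≈⟨ +-congʳ (+-comm _ _) ⟩
    suc m ⋆ x + - (suc n ⋆ x)          ∎

  •-distribʳ : ∀ i j x → (i ℤ.+ j) • x ≈ i • x + j • x
  •-distribʳ (+ m)    (+ n)    x = ×-homo-+ x m n
  •-distribʳ (+ m)    -[1+ n ] x = ⊖-• m (suc n) x
  •-distribʳ -[1+ m ] (+ n)    x = ≈-trans (⊖-• n (suc m) x) (+-comm _ _)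
  •-distribʳ -[1+ m ] -[1+ n ] x = begin
    - (suc (suc (m ℕ.+ n)) ⋆ x)        ≡⟨ cong (λ k → - (k ⋆ x)) (sym (cong suc (ℕ.+-suc m n))) ⟩
    - ((suc m ℕ.+ suc n) ⋆ x)          ≈⟨ -‿cong (×-homo-+ x (suc m) (suc n)) ⟩
    - (suc m ⋆ x + suc n ⋆ x)          ≈⟨ -‿+-comm _ _ ⟨
    - (suc m ⋆ x) + - (suc n ⋆ x)      ∎

  •-distribˡ : ∀ i x y → i • (x + y) ≈ i • x + i • y
  •-distribˡ (+ n)    x y = ×-distrib-+ x y n
  •-distribˡ -[1+ n ] x y = ≈-trans (-‿cong (×-distrib-+ x y (suc n))) (≈-sym (-‿+-comm _ _))

  neg-• : ∀ i x → (ℤ.- i) • x ≈ - (i • x)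
  neg-• (+ zero)  x = ≈-sym -0≈0
  neg-• (+ suc n) x = ≈-refl
  neg-• -[1+ n ]  x = ≈-sym (-‿involutive _)

  private
    *-•⁺ : ∀ n j x → (+ n ℤ.* j) • x ≈ n ⋆ (j • x)
    *-•⁺ zero    j x = ≈-refl
    *-•⁺ (suc n) j x = begin
      (+ suc n ℤ.* j) • x       ≈⟨ •-congʳ x (ℤ.suc-* (+ n) j) ⟩
      (j ℤ.+ + n ℤ.* j) • x     ≈⟨ •-distribʳ j _ x ⟩
      j • x + (+ n ℤ.* j) • x   ≈⟨ +-congˡ (*-•⁺ n j x) ⟩
      j • x + n ⋆ (j • x)       ∎

  *-• : ∀ i j x → (i ℤ.* j) • x ≈ i • (j • x)
  *-• (+ n)    j x = *-•⁺ n j x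
  *-• -[1+ n ] j x = begin
    (-[1+ n ] ℤ.* j) • x        ≈⟨ •-congʳ x (sym (ℤ.neg-distribˡ-* (+ suc n) j)) ⟩
    (ℤ.- (+ suc n ℤ.* j)) • x   ≈⟨ neg-• (+ suc n ℤ.* j) x ⟩
    - ((+ suc n ℤ.* j) • x)     ≈⟨ -‿cong (*-•⁺ (suc n) j x) ⟩
    - (suc n ⋆ (j • x))         ∎

  1-• : ∀ x → 1ℤ • x ≈ x
  1-• x = +-identityʳ x

  •-zero : ∀ i → i • 0# ≈ 0#
  •-zero i = begin
    i • 0#         ≈⟨ *-• i 0ℤ 0# ⟨
    (i ℤ.* 0ℤ) • 0# ≈⟨ •-congʳ 0# (ℤ.*-zeroʳ i) ⟩
    0#             ∎

  record Divisible (m : ℕ) (x : G) : Set where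
    constructor _,_
    field
      root   : G
      isRoot : (+ m) • root ≈ x

  infixl 7 _∙_

  _∙_ : ∀ {n} → Vec ℤ n → Vec G n → G
  []      ∙ []      = 0#
  (a ∷ u) ∙ (x ∷ ρ) = a • x + u ∙ ρ

  +-interchange : ∀ w x y z → (w + x) + (y + z) ≈ (w + y) + (x + z)
  +-interchange w x y z = begin
    (w + x) + (y + z)   ≈⟨ +-assoc w x _ ⟩
    w + (x + (y + z))   ≈⟨ +-congˡ (+-assoc x y z) ⟨
    w + ((x + y) + z)   ≈⟨ +-congˡ (+-congʳ (+-comm x y)) ⟩
    w + ((y + x) + z)   ≈⟨ +-congˡ (+-assoc y x z) ⟩
    w + (y + (x + z))   ≈⟨ +-assoc w y _ ⟨
    (w + y) + (x + z)   ∎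

  lin : ∀ {n} → ℤ → Vec ℤ n → ℤ → Vec ℤ n → Vec ℤ n
  lin c u e v = zipWith (λ a b → c ℤ.* a ℤ.+ e ℤ.* b) u v

  lin-∙ : ∀ {n} c (u : Vec ℤ n) e v ρ → lin c u e v ∙ ρ ≈ c • (u ∙ ρ) + e • (v ∙ ρ)
  lin-∙ c [] e [] [] = ≈-sym (≈-trans (+-cong (•-zero c) (•-zero e)) (+-identityˡ 0#))
  lin-∙ c (a ∷ u) e (b ∷ v) (x ∷ ρ) = begin
    (c ℤ.* a ℤ.+ e ℤ.* b) • x + lin c u e v ∙ ρ
      ≈⟨ +-cong (•-distribʳ (c ℤ.* a) (e ℤ.* b) x) (lin-∙ c u e v ρ) ⟩
    ((c ℤ.* a) • x + (e ℤ.* b) • x) + (c • (u ∙ ρ) + e • (v ∙ ρ))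
      ≈⟨ +-interchange _ _ _ _ ⟩
    ((c ℤ.* a) • x + c • (u ∙ ρ)) + ((e ℤ.* b) • x + e • (v ∙ ρ))
      ≈⟨ +-cong (+-congʳ (*-• c a x)) (+-congʳ (*-• e b x)) ⟩
    (c • (a • x) + c • (u ∙ ρ)) + (e • (b • x) + e • (v ∙ ρ))
      ≈⟨ +-cong (•-distribˡ c _ _) (•-distribˡ e _ _) ⟨
    c • (a • x + u ∙ ρ) + e • (b • x + v ∙ ρ)  ∎

  scale-∙ : ∀ {n} c (u : Vec ℤ n) ρ → map (c ℤ.*_) u ∙ ρ ≈ c • (u ∙ ρ)
  scale-∙ c [] [] = ≈-sym (•-zero c)
  scale-∙ c (a ∷ u) (x ∷ ρ) = ≈-trans (+-cong (*-• c a x) (scale-∙ c u ρ)) (≈-sym (•-distribˡ c _ _))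

  zeros-∙ : ∀ {n} (ρ : Vec G n) → replicate n 0ℤ ∙ ρ ≈ 0#
  zeros-∙ []      = ≈-refl
  zeros-∙ (x ∷ ρ) = ≈-trans (+-identityˡ _) (zeros-∙ ρ)

  unit : ∀ {n} → Fin n → Vec ℤ n
  unit {suc n} zero    = 1ℤ ∷ replicate n 0ℤ
  unit         (suc i) = 0ℤ ∷ unit i

  unit-∙ : ∀ {n} (i : Fin n) ρ → unit i ∙ ρ ≈ lookup ρ i
  unit-∙ zero    (x ∷ ρ) = ≈-trans (+-cong (1-• x) (zeros-∙ ρ)) (+-identityʳ x)
  unit-∙ (suc i) (x ∷ ρ) = ≈-trans (+-identityˡ _) (unit-∙ i ρ)

  -- Identities between ℤ-linear combinations whose scalars are integer polynomials are
  -- decided by comparing the normal forms of the coefficients.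
  module Solver where

    open ℤ-Solver.+-*-Solver public using (Polynomial; con; _:+_; _:*_; :-_)
      renaming (⟦_⟧ to ⟦_⟧ₚ; ⟦_⟧↓ to ⟦_⟧ₚ↓; var to scalar; prove to proveₚ)

    infixl 6 _⊕_ _⊝_
    infixr 7 _⊙_

    data Combination (k m : ℕ) : Set where
      atom : Fin m → Combination k m
      𝟘    : Combination k m
      _⊕_  : Combination k m → Combination k m → Combination k m
      _⊝_  : Combination k m → Combination k m → Combination k m
      _⊙_  : Polynomial k → Combination k m → Combination k m

    private variable k m : ℕ

    ⟦_⟧ : Combination k m → Vec ℤ k → Vec G m → G
    ⟦ atom i ⟧ κ Γ = lookup Γ i
    ⟦ 𝟘 ⟧      κ Γ = 0#
    ⟦ s ⊕ t ⟧  κ Γ = ⟦ s ⟧ κ Γ + ⟦ t ⟧ κ Γ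
    ⟦ s ⊝ t ⟧  κ Γ = ⟦ s ⟧ κ Γ + - ⟦ t ⟧ κ Γ
    ⟦ p ⊙ t ⟧  κ Γ = ⟦ p ⟧ₚ κ • ⟦ t ⟧ κ Γ

    unitₚ : Fin m → Vec (Polynomial k) m
    unitₚ {suc m} zero    = con 1ℤ ∷ replicate m (con 0ℤ)
    unitₚ         (suc i) = con 0ℤ ∷ unitₚ i

    linₚ : Polynomial k → Vec (Polynomial k) m → Polynomial k → Vec (Polynomial k) m →
           Vec (Polynomial k) m
    linₚ p u q v = zipWith (λ a b → p :* a :+ q :* b) u v

    coefficients : Combination k m → Vec (Polynomial k) m
    coefficients (atom i) = unitₚ i
    coefficients 𝟘        = replicate _ (con 0ℤ)
    coefficients (s ⊕ t)  = linₚ (con 1ℤ) (coefficients s) (con 1ℤ) (coefficients t)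
    coefficients (s ⊝ t)  = linₚ (con 1ℤ) (coefficients s) (con -1ℤ) (coefficients t)
    coefficients (p ⊙ t)  = map (p :*_) (coefficients t)

    module _ (κ : Vec ℤ k) where

      private
        ⟦_⟧s : Vec (Polynomial k) m → Vec ℤ m
        ⟦_⟧s = map (λ p → ⟦ p ⟧ₚ κ)

      zerosₚ-correct : ∀ m → ⟦ replicate m (con 0ℤ) ⟧s ≡ replicate m 0ℤ
      zerosₚ-correct m = Vec.map-replicate _ _ m

      unitₚ-correct : (i : Fin m) → ⟦ unitₚ i ⟧s ≡ unit i
      unitₚ-correct {suc m} zero    = cong (1ℤ ∷_) (zerosₚ-correct m)
      unitₚ-correct         (suc i) = cong (0ℤ ∷_) (unitₚ-correct i)

      linₚ-correct : ∀ p (u : Vec _ m) q v →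
                     ⟦ linₚ p u q v ⟧s ≡ lin (⟦ p ⟧ₚ κ) ⟦ u ⟧s (⟦ q ⟧ₚ κ) ⟦ v ⟧s
      linₚ-correct p []      q []      = refl
      linₚ-correct p (a ∷ u) q (b ∷ v) = cong (_ ∷_) (linₚ-correct p u q v)

      scaleₚ-correct : ∀ p (u : Vec _ m) → ⟦ map (p :*_) u ⟧s ≡ map (⟦ p ⟧ₚ κ ℤ.*_) ⟦ u ⟧s
      scaleₚ-correct p []      = refl
      scaleₚ-correct p (a ∷ u) = cong (_ ∷_) (scaleₚ-correct p u)

      linear : ∀ p (s : Combination k m) q t Γ →
               ⟦ coefficients s ⟧s ∙ Γ ≈ ⟦ s ⟧ κ Γ → ⟦ coefficients t ⟧s ∙ Γ ≈ ⟦ t ⟧ κ Γ →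
               ⟦ linₚ p (coefficients s) q (coefficients t) ⟧s ∙ Γ ≈
               ⟦ p ⟧ₚ κ • ⟦ s ⟧ κ Γ + ⟦ q ⟧ₚ κ • ⟦ t ⟧ κ Γ
      linear p s q t Γ hs ht = begin
        ⟦ linₚ p (coefficients s) q (coefficients t) ⟧s ∙ Γ
          ≡⟨ cong (_∙ Γ) (linₚ-correct p (coefficients s) q (coefficients t)) ⟩
        lin (⟦ p ⟧ₚ κ) ⟦ coefficients s ⟧s (⟦ q ⟧ₚ κ) ⟦ coefficients t ⟧s ∙ Γ
          ≈⟨ lin-∙ (⟦ p ⟧ₚ κ) ⟦ coefficients s ⟧s (⟦ q ⟧ₚ κ) ⟦ coefficients t ⟧s Γ ⟩
        ⟦ p ⟧ₚ κ • (⟦ coefficients s ⟧s ∙ Γ) + ⟦ q ⟧ₚ κ • (⟦ coefficients t ⟧s ∙ Γ)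
          ≈⟨ +-cong (•-congˡ (⟦ p ⟧ₚ κ) hs) (•-congˡ (⟦ q ⟧ₚ κ) ht) ⟩
        ⟦ p ⟧ₚ κ • ⟦ s ⟧ κ Γ + ⟦ q ⟧ₚ κ • ⟦ t ⟧ κ Γ  ∎

      correct : ∀ (s : Combination k m) Γ → ⟦ coefficients s ⟧s ∙ Γ ≈ ⟦ s ⟧ κ Γ
      correct (atom i) Γ = ≈-trans (≈-reflexive (cong (_∙ Γ) (unitₚ-correct i))) (unit-∙ i Γ)
      correct 𝟘        Γ = ≈-trans (≈-reflexive (cong (_∙ Γ) (zerosₚ-correct _))) (zeros-∙ Γ)
      correct (s ⊕ t)  Γ = ≈-trans (linear (con 1ℤ) s (con 1ℤ) t Γ (correct s Γ) (correct t Γ))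
        (+-cong (1-• _) (1-• _))
      correct (s ⊝ t)  Γ = ≈-trans (linear (con 1ℤ) s (con -1ℤ) t Γ (correct s Γ) (correct t Γ))
        (+-cong (1-• _) (≈-trans (neg-• 1ℤ _) (-‿cong (1-• _))))
      correct (p ⊙ t)  Γ = ≈-trans
        (≈-reflexive (cong (_∙ Γ) (scaleₚ-correct p (coefficients t))))
        (≈-trans (scale-∙ (⟦ p ⟧ₚ κ) ⟦ coefficients t ⟧s Γ) (•-congˡ (⟦ p ⟧ₚ κ) (correct t Γ)))

      coefficientwise : (u v : Vec (Polynomial k) m) →
                        map (λ p → ⟦ p ⟧ₚ↓ κ) u ≡ map (λ p → ⟦ p ⟧ₚ↓ κ) v → ⟦ u ⟧s ≡ ⟦ v ⟧s
      coefficientwise []      []      _  = refl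
      coefficientwise (p ∷ u) (q ∷ v) eq =
        cong₂ _∷_ (proveₚ κ p q (Vec.∷-injectiveˡ eq)) (coefficientwise u v (Vec.∷-injectiveʳ eq))

      prove : ∀ (Γ : Vec G m) s t →
              map (λ p → ⟦ p ⟧ₚ↓ κ) (coefficients s) ≡ map (λ p → ⟦ p ⟧ₚ↓ κ) (coefficients t) →
              ⟦ s ⟧ κ Γ ≈ ⟦ t ⟧ κ Γ
      prove Γ s t eq = begin
        ⟦ s ⟧ κ Γ                  ≈⟨ correct s Γ ⟨
        ⟦ coefficients s ⟧s ∙ Γ    ≡⟨ cong (_∙ Γ) (coefficientwise (coefficients s) (coefficients t) eq) ⟩
        ⟦ coefficients t ⟧s ∙ Γ    ≈⟨ correct t Γ ⟩
        ⟦ t ⟧ κ Γ                  ∎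

    a₀ : Polynomial (1 ℕ.+ k)
    a₀ = scalar zero
    a₁ : Polynomial (2 ℕ.+ k)
    a₁ = scalar (suc zero)
    a₂ : Polynomial (3 ℕ.+ k)
    a₂ = scalar (suc (suc zero))
    x₀ : Combination k (1 ℕ.+ m)
    x₀ = atom zero
    x₁ : Combination k (2 ℕ.+ m)
    x₁ = atom (suc zero)
    x₂ : Combination k (3 ℕ.+ m)
    x₂ = atom (suc (suc zero))
    x₃ : Combination k (4 ℕ.+ m)
    x₃ = atom (suc (suc (suc zero)))

  private open module S = Solver hiding (⟦_⟧)

  -- Substituting h = k z + u into m h = c z + w isolates a multiple of z. When z is a prime and u,
  -- w are prime to it, that multiple must vanish.
  collect-generator : ∀ c m k {h z u w} → h ≈ k • z + u → m • h ≈ c • z + w →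
                      (c ℤ.+ ℤ.- (m ℤ.* k)) • z ≈ m • u + - w
  collect-generator c m k {h} {z} {u} {w} h≈ mh≈ = ≈-trans
    (prove (c ∷ m ∷ k ∷ []) (z ∷ w ∷ []) ((a₀ :+ :- (a₁ :* a₂)) ⊙ x₀)
      ((a₀ ⊙ x₀ ⊕ x₁) ⊕ ((:- (a₁ :* a₂)) ⊙ x₀ ⊝ x₁)) refl)
    (≈-trans (+-congʳ (≈-trans (≈-sym mh≈) (•-congˡ m h≈)))
      (prove (m ∷ k ∷ []) (z ∷ u ∷ w ∷ []) (a₀ ⊙ (a₁ ⊙ x₀ ⊕ x₁) ⊕ ((:- (a₀ :* a₁)) ⊙ x₀ ⊝ x₂))
        (a₀ ⊙ x₁ ⊝ x₂) refl))

  difference-• : ∀ i j {z} → i • z + - (j • z) ≈ (i ℤ.+ ℤ.- j) • z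
  difference-• i j {z} = prove (i ∷ j ∷ []) (z ∷ []) (a₀ ⊙ x₀ ⊝ a₁ ⊙ x₀) ((a₀ :+ :- a₁) ⊙ x₀) refl

-- Ordered abelian groups.

record GenericallyOrdered (𝔾 : AbelianGroup 0ℓ 0ℓ) : Set₁ where
  open ℤ-Module 𝔾

  field
    Pos         : G → Set
    Pos-resp    : ∀ {x y} → x ≈ y → Pos x → Pos y
    Pos-+       : ∀ {x y} → Pos x → Pos y → Pos (x + y)
    ¬Pos-0      : ¬ Pos 0#
    trichotomy  : ∀ x → Pos x ⊎ x ≈ 0# ⊎ Pos (- x)
    somePos     : ∃ Pos
    -- A substitute for division by 2, which need not be possible in G. With `archimedean` it gives
    -- density of the multiples of every K > 0.
    halve       : ∀ {x} → Pos x → Σ[ y ∈ G ] Pos y × Pos (x + - (y + y))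
    archimedean : ∀ {x} → Pos x → ∀ y → Σ[ n ∈ ℕ ] Pos ((+ n) • x + - y)
    divisible?  : ∀ m .{{_ : NonZero m}} x → Dec (Divisible m x)
    -- In other words, z has order exactly m modulo m G and the span of ρ.
    generic     : ∀ m .{{_ : NonZero m}} {n} (ρ : Vec G n) →
                  Σ[ z ∈ G ] (∀ c a → Divisible m (c • z + a ∙ ρ) → (+ m) ℤ.∣ c)

module OrderedGroup {𝔾 : AbelianGroup 0ℓ 0ℓ} (𝕆 : GenericallyOrdered 𝔾) where

  open ℤ-Module 𝔾
  open Solver
  open GenericallyOrdered 𝕆

  infix 4 _≺_ _≺?_

  _≺_ : G → G → Set
  x ≺ y = Pos (y + - x)

  ≺-asym : ∀ {x y} → x ≺ y → ¬ y ≺ x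
  ≺-asym {x} {y} x≺y y≺x = ¬Pos-0 (Pos-resp
    (prove [] (x ∷ y ∷ []) ((x₁ ⊝ x₀) ⊕ (x₀ ⊝ x₁)) 𝟘 refl) (Pos-+ x≺y y≺x))

  ≺-trans : ∀ {x y z} → x ≺ y → y ≺ z → x ≺ z
  ≺-trans {x} {y} {z} x≺y y≺z = Pos-resp
    (prove [] (x ∷ y ∷ z ∷ []) ((x₁ ⊝ x₀) ⊕ (x₂ ⊝ x₁)) (x₂ ⊝ x₀) refl) (Pos-+ x≺y y≺z)

  ≺-resp : ∀ {x x′ y y′} → x ≈ x′ → y ≈ y′ → x ≺ y → x′ ≺ y′
  ≺-resp x≈x′ y≈y′ = Pos-resp (+-cong y≈y′ (-‿cong x≈x′))

  compare : ∀ x y → x ≺ y ⊎ x ≈ y ⊎ y ≺ x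
  compare x y with trichotomy (y + - x)
  ... | inj₁ x≺y        = inj₁ x≺y
  ... | inj₂ (inj₁ eq)  = inj₂ (inj₁ (≈-trans (≈-sym (+-identityˡ x)) (≈-trans (+-congʳ (≈-sym eq))
    (prove [] (x ∷ y ∷ []) ((x₁ ⊝ x₀) ⊕ x₀) x₁ refl))))
  ... | inj₂ (inj₂ y≺x) = inj₂ (inj₂ (Pos-resp (prove [] (x ∷ y ∷ []) (𝟘 ⊝ (x₁ ⊝ x₀)) (x₀ ⊝ x₁) refl)
    (Pos-resp (≈-sym (+-identityˡ _)) y≺x)))

  _≺?_ : ∀ x y → Dec (x ≺ y)
  x ≺? y with compare x y
  ... | inj₁ x≺y        = yes x≺y
  ... | inj₂ (inj₁ x≈y) = no λ x≺y → ¬Pos-0 (Pos-resp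
    (≈-trans (+-congʳ (≈-sym x≈y)) (-‿inverseʳ x)) x≺y)
  ... | inj₂ (inj₂ y≺x) = no (≺-asym y≺x)

  Pos-• : ∀ m .{{_ : NonZero m}} {x} → Pos x → Pos ((+ m) • x)
  Pos-• (suc zero)    x>0 = Pos-resp (≈-sym (+-identityʳ _)) x>0
  Pos-• (suc (suc m)) x>0 = Pos-+ x>0 (Pos-• (suc m) x>0)

  Pos-•⁻ : ∀ m .{{_ : NonZero m}} {x} → Pos ((+ m) • x) → Pos x
  Pos-•⁻ m {x} mx>0 with trichotomy x
  ... | inj₁ x>0        = x>0
  ... | inj₂ (inj₁ x≈0) = contradiction (Pos-resp (≈-trans (•-congˡ (+ m) x≈0) (•-zero (+ m))) mx>0) ¬Pos-0
  ... | inj₂ (inj₂ x<0) = contradiction (Pos-resp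
    (prove ((+ m) ∷ []) (x ∷ []) (a₀ ⊙ x₀ ⊕ a₀ ⊙ (𝟘 ⊝ x₀)) 𝟘 refl)
    (Pos-+ mx>0 (Pos-• m (Pos-resp (≈-sym (+-identityˡ _)) x<0)))) ¬Pos-0

  -- Ordered groups are torsion-free: a strict inequality between x and y would survive
  -- multiplication by m.
  •-injective : ∀ m .{{_ : NonZero m}} {x y} → (+ m) • x ≈ (+ m) • y → x ≈ y
  •-injective m {x} {y} eq with compare x y
  ... | inj₂ (inj₁ x≈y) = x≈y
  ... | inj₁ x≺y        = contradiction (Pos-resp (≈-trans
    (prove ((+ m) ∷ []) (x ∷ y ∷ []) (a₀ ⊙ (x₁ ⊝ x₀)) (a₀ ⊙ x₁ ⊝ a₀ ⊙ x₀) refl)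
    (≈-trans (+-congˡ (-‿cong eq)) (-‿inverseʳ _))) (Pos-• m x≺y)) ¬Pos-0
  ... | inj₂ (inj₂ y≺x) = contradiction (Pos-resp (≈-trans
    (prove ((+ m) ∷ []) (x ∷ y ∷ []) (a₀ ⊙ (x₀ ⊝ x₁)) (a₀ ⊙ x₀ ⊝ a₀ ⊙ x₁) refl)
    (≈-trans (+-congʳ eq) (-‿inverseʳ _))) (Pos-• m y≺x)) ¬Pos-0

  Divisible-resp : ∀ {m x y} → x ≈ y → Divisible m x → Divisible m y
  Divisible-resp x≈y (h , eq) = h , ≈-trans eq x≈y

  Divisible-+ : ∀ {m x y} → Divisible m x → Divisible m y → Divisible m (x + y)
  Divisible-+ {m} (h , hx) (k , ky) = h + k , ≈-trans (•-distribˡ (+ m) h k) (+-cong hx ky)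

  Divisible-• : ∀ {m x} c → Divisible m x → Divisible m (c • x)
  Divisible-• {m} c (h , hx) = c • h ,
    ≈-trans (prove ((+ m) ∷ c ∷ []) (h ∷ []) (a₀ ⊙ a₁ ⊙ x₀) (a₁ ⊙ a₀ ⊙ x₀) refl) (•-congˡ c hx)

  Divisible-multiple : ∀ {m} x → Divisible m ((+ m) • x)
  Divisible-multiple x = x , ≈-refl

  Divisible-scale : ∀ c {m x} → Divisible m x → Divisible (c ℕ.* m) ((+ c) • x)
  Divisible-scale c {m} (h , hx) = h , ≈-trans (•-congʳ h (ℤ.pos-* c m))
    (≈-trans (*-• (+ c) (+ m) h) (•-congˡ (+ c) hx))

  Divisible-unscale : ∀ c .{{_ : NonZero c}} {m x} → Divisible (c ℕ.* m) ((+ c) • x) → Divisible m x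
  Divisible-unscale c {m} (h , hx) = h , •-injective c
    (≈-trans (≈-sym (*-• (+ c) (+ m) h)) (≈-trans (•-congʳ h (sym (ℤ.pos-* c m))) hx))

  Divisible-∣ : ∀ {d m x} → d ℕ.∣ m → Divisible m x → Divisible d x
  Divisible-∣ {d} (ℕ.divides k refl) (h , hx) = (+ k) • h ,
    ≈-trans (prove ((+ k) ∷ (+ d) ∷ []) (h ∷ []) (a₁ ⊙ a₀ ⊙ x₀) ((a₀ :* a₁) ⊙ x₀) refl)
      (≈-trans (•-congʳ h (sym (ℤ.pos-* k d))) hx)

  -- Density of the multiples of K

  -- One halving per unit of K: with 2 δ′ < δ and both ε and K ε below δ′, the sum (K + 1) ε is
  -- below δ. The clause ε ≺ δ is there for this induction.
  smaller : ∀ K {δ} → Pos δ → Σ[ ε ∈ G ] Pos ε × ε ≺ δ × (+ K) • ε ≺ δ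
  smaller zero {δ} δ>0 with halve δ>0
  ... | ε , ε>0 , 2ε<δ = ε , ε>0 ,
    Pos-resp (prove [] (δ ∷ ε ∷ []) ((x₀ ⊝ (x₁ ⊕ x₁)) ⊕ x₁) (x₀ ⊝ x₁) refl) (Pos-+ 2ε<δ ε>0) ,
    Pos-resp (prove [] (δ ∷ []) x₀ (x₀ ⊝ 𝟘) refl) δ>0
  smaller (suc K) {δ} δ>0 with halve δ>0
  ... | δ′ , δ′>0 , 2δ′<δ with smaller K δ′>0
  ... | ε , ε>0 , ε<δ′ , Kε<δ′ = ε , ε>0 ,
    ≺-trans ε<δ′ (Pos-resp (prove [] (δ ∷ δ′ ∷ []) ((x₀ ⊝ (x₁ ⊕ x₁)) ⊕ x₁) (x₀ ⊝ x₁) refl) (Pos-+ 2δ′<δ δ′>0)) ,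
    Pos-resp (prove [] (δ ∷ δ′ ∷ ε ∷ (+ K) • ε ∷ [])
      ((x₀ ⊝ (x₁ ⊕ x₁)) ⊕ ((x₁ ⊝ x₂) ⊕ (x₁ ⊝ x₃))) (x₀ ⊝ (x₂ ⊕ x₃)) refl)
      (Pos-+ 2δ′<δ (Pos-+ ε<δ′ Kε<δ′))

  -- A linear search upwards from j. The invariant ¬ x ≺ j • η becomes the second half of the
  -- conclusion at the first success, and n bounds the number of steps.
  climb : ∀ x η n j → ¬ x ≺ j • η → x ≺ (j ℤ.+ + n) • η →
          Σ[ i ∈ ℤ ] x ≺ i • η × ¬ x ≺ (i ℤ.+ -1ℤ) • η
  climb x η zero    j ¬lo hi = contradiction
    (≺-resp ≈-refl (•-congʳ η (ℤ.+-identityʳ j)) hi) ¬lo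
  climb x η (suc n) j ¬lo hi with x ≺? (j ℤ.+ 1ℤ) • η
  ... | yes lo = j ℤ.+ 1ℤ , lo , ¬lo ∘ ≺-resp ≈-refl (•-congʳ η
    (trans (ℤ.+-assoc j 1ℤ -1ℤ) (ℤ.+-identityʳ j)))
  ... | no ¬lo′ = climb x η n (j ℤ.+ 1ℤ) ¬lo′ (≺-resp ≈-refl (•-congʳ η
    (sym (ℤ.+-assoc j 1ℤ (+ n)))) hi)

  -- The multiples of η = K ε form a grid of mesh below y - x, so the first grid point above x is
  -- still below y. The Archimedean property, applied to -x and to x, brackets x between grid
  -- points.
  dense : ∀ K .{{_ : NonZero K}} {x y} → x ≺ y → Σ[ r ∈ G ] x ≺ (+ K) • r × (+ K) • r ≺ y
  dense K {x} {y} x≺y with smaller K x≺y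
  ... | ε , ε>0 , _ , η<y-x with archimedean (Pos-• K ε>0) (- x) | archimedean (Pos-• K ε>0) x
  ... | m , -x<mη | n , x<nη with climb x ((+ K) • ε) (m ℕ.+ n) (ℤ.- (+ m)) start finish
    where
    start : ¬ x ≺ (ℤ.- (+ m)) • ((+ K) • ε)
    start = ≺-asym (Pos-resp (prove ((+ m) ∷ []) ((+ K) • ε ∷ x ∷ []) (a₀ ⊙ x₀ ⊝ (𝟘 ⊝ x₁)) (x₁ ⊝ (:- a₀) ⊙ x₀) refl)
      (Pos-resp (+-congˡ (-‿cong (≈-sym (+-identityˡ _)))) -x<mη))
    finish : x ≺ (ℤ.- (+ m) ℤ.+ (+ (m ℕ.+ n))) • ((+ K) • ε)
    finish = ≺-resp ≈-refl (•-congʳ _ (trans (sym (ℤ.+-identityˡ (+ n)))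
      (trans (cong (λ k → k ℤ.+ + n) (sym (ℤ.+-inverseˡ (+ m)))) (ℤ.+-assoc (ℤ.- + m) (+ m) (+ n))))) x<nη
  ... | i , x<iη , ¬x<[i-1]η = i • ε , ≺-resp ≈-refl swap x<iη , ≺-resp swap ≈-refl iη<y
    where
    swap : i • ((+ K) • ε) ≈ (+ K) • (i • ε)
    swap = prove (i ∷ (+ K) ∷ []) (ε ∷ []) (a₀ ⊙ a₁ ⊙ x₀) (a₁ ⊙ a₀ ⊙ x₀) refl
    η = (+ K) • ε
    -- y - i η is the sum of y - x - η, positive by the choice of ε, and x - (i - 1) η, which is not
    -- negative.
    split : (y + - x) + - η + (x + - ((i ℤ.+ -1ℤ) • η)) ≈ y + - (i • η)
    split = prove (i ∷ []) (η ∷ x ∷ y ∷ [])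
      (x₂ ⊝ x₁ ⊝ x₀ ⊕ (x₁ ⊝ (a₀ :+ con -1ℤ) ⊙ x₀)) (x₂ ⊝ a₀ ⊙ x₀) refl
    iη<y : i • η ≺ y
    iη<y with compare x ((i ℤ.+ -1ℤ) • η)
    ... | inj₁ x<[i-1]η        = contradiction x<[i-1]η ¬x<[i-1]η
    ... | inj₂ (inj₁ x≈[i-1]η) = Pos-resp
      (≈-trans (≈-sym (+-identityʳ _)) (≈-trans (+-congˡ (≈-sym (-‿inverseʳ x)))
        (≈-trans (+-congˡ (+-congˡ (-‿cong x≈[i-1]η))) split))) η<y-x
    ... | inj₂ (inj₂ [i-1]η<x) = Pos-resp split (Pos-+ η<y-x [i-1]η<x)

private variable
  X Y : Set
  n   : ℕ

-- Finite search

singletonIf : {P : Set} {Q : X → Set} → Dec P → (P → ∃ Q) → Σ[ xs ∈ List X ] (P → ∃[ x ] x ∈ xs × Q x)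
singletonIf (no ¬p) f = [] , λ p → contradiction p ¬p
singletonIf (yes p) f = proj₁ (f p) ∷ [] , λ _ → proj₁ (f p) , here refl , proj₂ (f p)

-- Uniformity is the point: the list is fixed by `as` alone, before any `a` and any evidence for
-- `H a` is given.
collect : {H : X → Set} {Q : X → Y → Set} →
          (∀ a → Σ[ xs ∈ List Y ] (H a → ∃[ x ] x ∈ xs × Q a x)) →
          ∀ as → Σ[ xs ∈ List Y ] (∀ {a} → a ∈ as → H a → ∃[ x ] x ∈ xs × Q a x)
collect f as = concatMap (proj₁ ∘ f) as , λ {a} a∈as Ha →
  let x , x∈ , Qx = proj₂ (f a) Ha
  in  x , ∈-concatMap⁺ (proj₁ ∘ f) (lose a∈as x∈) , Qx

least : {P : ℕ → Set} → Decidable P → ∀ m → P m → ∃[ d ] P d × (∀ {c} → c < d → ¬ P c)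
least {P} P? = <-rec _ λ m rec Pm → step m rec Pm (ℕ.anyUpTo? P? m)
  where
  step : ∀ m → (∀ {c} → c < m → P c → _) → P m → Dec (∃ λ c → c < m × P c) →
         ∃[ d ] P d × (∀ {c} → c < d → ¬ P c)
  step m rec Pm (yes (c , c<m , Pc)) = rec c<m Pc
  step m rec Pm (no none)            = m , Pm , λ c<m Pc → none (_ , c<m , Pc)

-- The cut of an unknown extension is one of these. All are listed in advance, and those not
-- separated over σ are discarded by `admissible?`.
splits : List X → List (List X × List X)
splits []       = ([] , []) ∷ []
splits (x ∷ xs) = List.map (λ (ls , hs) → x ∷ ls , hs) (splits xs) ++
                  List.map (λ (ls , hs) → ls , x ∷ hs) (splits xs)

splits-complete : {P Q : X → Set} (xs : List X) → (∀ {x} → x ∈ xs → P x ⊎ Q x) →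
                  ∃[ s ] s ∈ splits xs × All P (proj₁ s) × All Q (proj₂ s) ×
                         (∀ {x} → x ∈ xs → x ∈ proj₁ s ⊎ x ∈ proj₂ s)
splits-complete [] _ = _ , here refl , [] , [] , λ ()
splits-complete {X} {P} {Q} (x ∷ xs) f with splits-complete xs (f ∘ there) | f (here refl)
... | (ls , hs) , s∈ , Pls , Qhs , cover | inj₁ Px =
  _ , ∈-++⁺ˡ (∈-map⁺ _ s∈) , Px ∷ Pls , Qhs , cover′
  where
  cover′ : ∀ {y} → y ∈ x ∷ xs → y ∈ x ∷ ls ⊎ y ∈ hs
  cover′ (here eq) = inj₁ (here eq)
  cover′ (there y∈) with cover y∈
  ... | inj₁ y∈ls = inj₁ (there y∈ls)
  ... | inj₂ y∈hs = inj₂ y∈hs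
... | (ls , hs) , s∈ , Pls , Qhs , cover | inj₂ Qx =
  _ , ∈-++⁺ʳ (List.map _ (splits xs)) (∈-map⁺ _ s∈) , Pls , Qx ∷ Qhs , cover′
  where
  cover′ : ∀ {y} → y ∈ x ∷ xs → y ∈ ls ⊎ y ∈ x ∷ hs
  cover′ (here eq) = inj₂ (here eq)
  cover′ (there y∈) with cover y∈
  ... | inj₁ y∈ls = inj₁ y∈ls
  ... | inj₂ y∈hs = inj₂ (there y∈hs)

-- Integer vectors of bounded size

Bounded : ℕ → Vec ℤ n → Set
Bounded b = VecAll.All (λ z → ∣ z ∣ ≤ b)

Bounded-mono : ∀ {b c} {u : Vec ℤ n} → b ≤ c → Bounded b u → Bounded c u
Bounded-mono b≤c = VecAll.map (λ z≤b → ℕ.≤-trans z≤b b≤c)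

range : ℕ → List ℤ
range b = List.map +_ (upTo (suc b)) ++ List.map (λ k → ℤ.- (+ k)) (upTo (suc b))

∈-range⁺ : ∀ {b} z → ∣ z ∣ ≤ b → z ∈ range b
∈-range⁺ (+ k)        k≤b = ∈-++⁺ˡ (∈-map⁺ +_ (∈-upTo⁺ (s≤s k≤b)))
∈-range⁺ {b} -[1+ k ] k<b = ∈-++⁺ʳ (List.map +_ (upTo (suc b))) (∈-map⁺ (λ k → ℤ.- (+ k)) (∈-upTo⁺ (s≤s k<b)))

∈-range⁻ : ∀ {b z} → z ∈ range b → ∣ z ∣ ≤ b
∈-range⁻ {b} z∈ with ∈-++⁻ (List.map +_ (upTo (suc b))) z∈
... | inj₁ z∈⁺ with k , k∈ , refl ← ∈-map⁻ +_ z∈⁺ = ℕ.≤-pred (∈-upTo⁻ k∈)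
... | inj₂ z∈⁻ with k , k∈ , refl ← ∈-map⁻ (λ k → ℤ.- (+ k)) z∈⁻ =
  subst (_≤ b) (sym (ℤ.∣-i∣≡∣i∣ (+ k))) (ℕ.≤-pred (∈-upTo⁻ k∈))

box : ℕ → (n : ℕ) → List (Vec ℤ n)
box b zero    = [] ∷ []
box b (suc n) = cartesianProductWith _∷_ (range b) (box b n)

∈-box⁺ : ∀ {b} {u : Vec ℤ n} → Bounded b u → u ∈ box b n
∈-box⁺ []            = here refl
∈-box⁺ (z≤b ∷ u≤b) = ∈-cartesianProductWith⁺ _∷_ (∈-range⁺ _ z≤b) (∈-box⁺ u≤b)

∈-box⁻ : ∀ {b} {u : Vec ℤ n} → u ∈ box b n → Bounded b u
∈-box⁻ {n = zero} {u = []} _ = []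
∈-box⁻ {n = suc n} {b} u∈
  with z , v , z∈ , v∈ , refl ← ∈-cartesianProductWith⁻ _∷_ (range b) (box b n) u∈ =
  ∈-range⁻ z∈ ∷ ∈-box⁻ v∈

∣*∣-≤ : ∀ {b c} x y → ∣ x ∣ ≤ b → ∣ y ∣ ≤ c → ∣ x ℤ.* y ∣ ≤ b ℕ.* c
∣*∣-≤ {b} {c} x y x≤b y≤c = subst (_≤ b ℕ.* c) (sym (ℤ.abs-* x y)) (ℕ.*-mono-≤ x≤b y≤c)

-- The back-and-forth argument.

module BackAndForth {𝔾 : AbelianGroup 0ℓ 0ℓ} (𝕆 : GenericallyOrdered 𝔾) where

  open ℤ-Module 𝔾
  open Solver
  open GenericallyOrdered 𝕆
  open OrderedGroup 𝕆

  Bounded-lin : ∀ {c e C E b b′} {u v : Vec ℤ n} → ∣ c ∣ ≤ C → ∣ e ∣ ≤ E →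
                Bounded b u → Bounded b′ v → Bounded (C ℕ.* b ℕ.+ E ℕ.* b′) (lin c u e v)
  Bounded-lin c≤C e≤E []          []            = []
  Bounded-lin {c = c} {e} {u = x ∷ u} {v = y ∷ v} c≤C e≤E (x≤b ∷ u≤b) (y≤b′ ∷ v≤b′) =
    ℕ.≤-trans (ℤ.∣i+j∣≤∣i∣+∣j∣ (c ℤ.* x) (e ℤ.* y))
      (ℕ.+-mono-≤ (∣*∣-≤ c x c≤C x≤b) (∣*∣-≤ e y e≤E y≤b′))
    ∷ Bounded-lin {c = c} {e} c≤C e≤E u≤b v≤b′

  Bounded-scale : ∀ {c C b} {u : Vec ℤ n} → ∣ c ∣ ≤ C → Bounded b u → Bounded (C ℕ.* b) (map (c ℤ.*_) u)
  Bounded-scale c≤C []                         = []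
  Bounded-scale {c = c} {u = x ∷ _} c≤C (x≤b ∷ u≤b) = ∣*∣-≤ c x c≤C x≤b ∷ Bounded-scale {c = c} c≤C u≤b

  -- Coefficients are bounded for `pos` alone: divisibility by M depends on them modulo M, so
  -- quantifying over all of them still imposes finitely many conditions.
  record _[_,_]⟶_ (ρ : Vec G n) (N M : ℕ) (σ : Vec G n) : Set where
    constructor preserves
    field
      pos : ∀ {a} → Bounded N a → Pos (a ∙ ρ) → Pos (a ∙ σ)
      dvd : ∀ a → Divisible M (a ∙ ρ) → Divisible M (a ∙ σ)

  open _[_,_]⟶_

  -- d ∣ x iff k d ∣ k x, so one modulus accounts for all its divisors.

  dvd-∣ : ∀ {N M d} .{{_ : NonZero M}} {ρ σ : Vec G n} → ρ [ N , M ]⟶ σ → d ℕ.∣ M →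
          ∀ a → Divisible d (a ∙ ρ) → Divisible d (a ∙ σ)
  dvd-∣ {d = d} {ρ = ρ} {σ} ρ⟶σ (ℕ.divides zero refl) a d∣aρ = contradiction refl (ℕ.≢-nonZero⁻¹ 0)
  dvd-∣ {d = d} {ρ = ρ} {σ} ρ⟶σ (ℕ.divides k@(suc _) refl) a d∣aρ =
    Divisible-unscale k (Divisible-resp (scale-∙ (+ k) a σ) (dvd ρ⟶σ (map (+ k ℤ.*_) a)
      (Divisible-resp (≈-sym (scale-∙ (+ k) a ρ)) (Divisible-scale k d∣aρ))))

  mono : ∀ {N N′ M M′} .{{_ : NonZero M′}} {ρ σ : Vec G n} → N ≤ N′ → M ℕ.∣ M′ →
         ρ [ N′ , M′ ]⟶ σ → ρ [ N , M ]⟶ σ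
  mono N≤N′ M∣M′ ρ⟶σ .pos a≤N = pos ρ⟶σ (Bounded-mono N≤N′ a≤N)
  mono N≤N′ M∣M′ ρ⟶σ .dvd     = dvd-∣ ρ⟶σ M∣M′

  -- d is the order of q modulo M G and the span of ρ. By `minimal`, every congruence on q is a
  -- multiple of `relation` plus a congruence on ρ alone.
  record Coset (M d : ℕ) (b : Vec ℤ n) (q : G) (ρ : Vec G n) : Set where
    field
      relation : Divisible M ((+ d) • q + - (b ∙ ρ))
      minimal  : ∀ c a → Divisible M (c • q + a ∙ ρ) → (+ d) ℤ.∣ c

  record Cut (L : ℕ) (lows highs : List (Vec ℤ n)) (q : G) (ρ : Vec G n) : Set where
    field
      below : All (λ u → u ∙ ρ ≺ (+ L) • q) lows
      above : All (λ u → (+ L) • q ≺ u ∙ ρ) highs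

  Separated : (lows highs : List (Vec ℤ n)) (ρ : Vec G n) → Set
  Separated lows highs ρ = All (λ u → All (λ v → u ∙ ρ ≺ v ∙ ρ) highs) lows

  -- Separation of finite sets

  -- y is the least of x + ω and the members of `hs`, for a fixed ω > 0 that covers the case of
  -- empty `hs`.
  raise : ∀ x hs → All (x ≺_) hs → Σ[ y ∈ G ] x ≺ y × (∀ z → z ≺ y → All (z ≺_) hs)
  raise x [] [] with somePos
  ... | ω , ω>0 = x + ω , Pos-resp (prove [] (x ∷ ω ∷ []) x₁ ((x₀ ⊕ x₁) ⊝ x₀) refl) ω>0 , λ _ _ → []
  raise x (h ∷ hs) (x<h ∷ x<hs) with raise x hs x<hs
  ... | y , x<y , y≤hs with compare y h
  ... | inj₁ y<h        = y , x<y , λ z z<y → ≺-trans z<y y<h ∷ y≤hs z z<y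
  ... | inj₂ (inj₁ y≈h) = y , x<y , λ z z<y → ≺-resp ≈-refl y≈h z<y ∷ y≤hs z z<y
  ... | inj₂ (inj₂ h<y) = h , x<h , λ z z<h → z<h ∷ y≤hs z (≺-trans z<h h<y)

  lower : ∀ hs → Σ[ x ∈ G ] All (x ≺_) hs
  lower [] = 0# , []
  lower (h ∷ hs) with lower hs | somePos
  ... | x , x<hs | ω , ω>0 with x ≺? h
  ... | yes x<h = x , x<h ∷ x<hs
  ... | no ¬x<h = h + - ω , h-ω<h ∷ All.map (below-x ¬x<h) x<hs
    where
    h-ω<h : h + - ω ≺ h
    h-ω<h = Pos-resp (prove [] (h ∷ ω ∷ []) x₁ (x₀ ⊝ (x₀ ⊝ x₁)) refl) ω>0
    below-x : ¬ x ≺ h → ∀ {y} → x ≺ y → h + - ω ≺ y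
    below-x ¬x<h x<y with compare x h
    ... | inj₁ x<h        = contradiction x<h ¬x<h
    ... | inj₂ (inj₁ x≈h) = ≺-trans h-ω<h (≺-resp x≈h ≈-refl x<y)
    ... | inj₂ (inj₂ h<x) = ≺-trans (≺-trans h-ω<h h<x) x<y

  lowerAbove : ∀ ls hs → All (λ l → All (l ≺_) hs) ls →
               Σ[ x ∈ G ] All (x ≺_) hs × (∀ z → x ≺ z → All (_≺ z) ls)
  lowerAbove [] hs [] with lower hs
  ... | x , x<hs = x , x<hs , λ _ _ → []
  lowerAbove (l ∷ ls) hs (l<hs ∷ ls<hs) with lowerAbove ls hs ls<hs
  ... | x , x<hs , ls≤x with compare l x
  ... | inj₁ l<x        = x , x<hs , λ z x<z → ≺-trans l<x x<z ∷ ls≤x z x<z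
  ... | inj₂ (inj₁ l≈x) = x , x<hs , λ z x<z → ≺-resp (≈-sym l≈x) ≈-refl x<z ∷ ls≤x z x<z
  ... | inj₂ (inj₂ x<l) = l , l<hs , λ z l<z → l<z ∷ ls≤x z (≺-trans x<l l<z)

  -- The two finite sets reduce to one interval, bounded by the extremes found by `lowerAbove` and
  -- `raise`. Translated by -c, it contains a multiple of K by density.
  between : ∀ K .{{_ : NonZero K}} c ls hs → All (λ l → All (l ≺_) hs) ls →
            Σ[ r ∈ G ] All (_≺ c + (+ K) • r) ls × All (c + (+ K) • r ≺_) hs
  between K c ls hs ls<hs =
    let x , x<hs , ls≤x    = lowerAbove ls hs ls<hs
        y , x<y , y≤hs     = raise x hs x<hs
        r , x-c<Kr , Kr<y-c = dense K (shifted x y x<y)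
        w                  = (+ K) • r
    in  r , ls≤x (c + w) (Pos-resp (shiftˡ x w) x-c<Kr) , y≤hs (c + w) (Pos-resp (shiftʳ y w) Kr<y-c)
    where
    shifted : ∀ x y → x ≺ y → x + - c ≺ y + - c
    shifted x y = Pos-resp (prove [] (c ∷ x ∷ y ∷ []) (x₂ ⊝ x₁) ((x₂ ⊝ x₀) ⊝ (x₁ ⊝ x₀)) refl)
    shiftˡ : ∀ x w → w + - (x + - c) ≈ (c + w) + - x
    shiftˡ x w = prove [] (c ∷ x ∷ w ∷ []) (x₂ ⊝ (x₁ ⊝ x₀)) ((x₀ ⊕ x₂) ⊝ x₁) refl
    shiftʳ : ∀ y w → (y + - c) + - w ≈ y + - (c + w)
    shiftʳ y w = prove [] (c ∷ y ∷ w ∷ []) ((x₁ ⊝ x₀) ⊝ x₂) (x₁ ⊝ (x₀ ⊕ x₂)) refl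

  Pos-•-⇔ : ∀ k .{{_ : NonZero k}} {x y} → (+ k) • x ≈ y → (Pos x → Pos y) × (Pos y → Pos x)
  Pos-•-⇔ k eq = (λ x>0 → Pos-resp eq (Pos-• k x>0)) , (λ y>0 → Pos-•⁻ k (Pos-resp (≈-sym eq) y>0))

  -- L (e q + b ρ) = (L b + e u) ρ, so multiplication by L turns statements about q and ρ into
  -- statements about ρ alone. The bound is that of L b + e u, and M ∣ x becomes L M ∣ L x.
  root-step : ∀ {L N B M} .{{_ : NonZero L}} {ρ σ : Vec G n} {q q′ u} → Bounded B u →
              (+ L) • q ≈ u ∙ ρ → (+ L) • q′ ≈ u ∙ σ →
              ρ [ L ℕ.* N ℕ.+ N ℕ.* B , L ℕ.* M ]⟶ σ → (q ∷ ρ) [ N , M ]⟶ (q′ ∷ σ)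
  root-step {L = L} {N} {ρ = ρ} {σ} {q} {q′} {u} u≤B Lq≈uρ Lq′≈uσ ρ⟶σ = record
    { pos = λ { {e ∷ b} (e≤N ∷ b≤N) →
        proj₂ (Pos-•-⇔ L (scaled e b Lq′≈uσ)) ∘
        pos ρ⟶σ (Bounded-lin {c = + L} {e} ℕ.≤-refl e≤N b≤N u≤B) ∘
        proj₁ (Pos-•-⇔ L (scaled e b Lq≈uρ)) }
    ; dvd = λ { (e ∷ b) →
        Divisible-unscale L ∘ Divisible-resp (≈-sym (scaled e b Lq′≈uσ)) ∘
        dvd ρ⟶σ (lin (+ L) b e u) ∘
        Divisible-resp (scaled e b Lq≈uρ) ∘ Divisible-scale L }
    }
    where
    scaled : ∀ {ρ q} e b → (+ L) • q ≈ u ∙ ρ → (+ L) • (e • q + b ∙ ρ) ≈ lin (+ L) b e u ∙ ρ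
    scaled {ρ} {q} e b eq = ≈-trans
      (prove ((+ L) ∷ e ∷ []) (q ∷ b ∙ ρ ∷ []) (a₀ ⊙ (a₁ ⊙ x₀ ⊕ x₁)) (a₀ ⊙ x₁ ⊕ a₁ ⊙ a₀ ⊙ x₀) refl)
      (≈-trans (+-congˡ (•-congˡ e eq)) (≈-sym (lin-∙ (+ L) b e u ρ)))

  -- Minimality gives e = k d. Subtracting k times the coset relation leaves M ∣ (k b + a) ρ, which
  -- transfers to σ; adding back k times the relation of q′ returns to e q′ + a σ.
  coset-dvd : ∀ {M d N′ M′ b} .{{_ : NonZero M′}} {ρ σ : Vec G n} {q q′} →
              Coset M d b q ρ → Coset M d b q′ σ → M ℕ.∣ M′ → ρ [ N′ , M′ ]⟶ σ →
              ∀ a → Divisible M (a ∙ (q ∷ ρ)) → Divisible M (a ∙ (q′ ∷ σ))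
  coset-dvd {M = M} {d} {b = b} {ρ} {σ} {q} {q′} C C′ M∣M′ ρ⟶σ (e ∷ a) M∣eq+aρ
    with Coset.minimal C e a M∣eq+aρ
  ... | divides k refl = Divisible-resp back
    (Divisible-+ (dvd-∣ ρ⟶σ M∣M′ (lin k b 1ℤ a)
       (Divisible-resp forth (Divisible-+ M∣eq+aρ (Divisible-• (ℤ.- k) (Coset.relation C)))))
      (Divisible-• k (Coset.relation C′)))
    where
    forth : ((k ℤ.* + d) • q + a ∙ ρ) + (ℤ.- k) • ((+ d) • q + - (b ∙ ρ)) ≈ lin k b 1ℤ a ∙ ρ
    forth = ≈-trans (prove (k ∷ + d ∷ []) (q ∷ a ∙ ρ ∷ b ∙ ρ ∷ [])
      (((a₀ :* a₁) ⊙ x₀ ⊕ x₁) ⊕ (:- a₀) ⊙ (a₁ ⊙ x₀ ⊝ x₂)) (a₀ ⊙ x₂ ⊕ con 1ℤ ⊙ x₁) refl)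
      (≈-sym (lin-∙ k b 1ℤ a ρ))
    back : lin k b 1ℤ a ∙ σ + k • ((+ d) • q′ + - (b ∙ σ)) ≈ (k ℤ.* + d) • q′ + a ∙ σ
    back = ≈-trans (+-congʳ (lin-∙ k b 1ℤ a σ)) (prove (k ∷ + d ∷ []) (q′ ∷ a ∙ σ ∷ b ∙ σ ∷ [])
      ((a₀ ⊙ x₂ ⊕ con 1ℤ ⊙ x₁) ⊕ a₀ ⊙ (a₁ ⊙ x₀ ⊝ x₂)) ((a₀ :* a₁) ⊙ x₀ ⊕ x₁) refl)

  -- For 0 < e ∣ L, the sign of e q + a ρ is that of L q - u ρ with u = - (L / e) a.

  cut-pos : ∀ {L N M} .{{_ : NonZero L}} {lows highs} {ρ σ : Vec G n} {q q′} →
            (∀ {e} → suc e ≤ N → suc e ℕ.∣ L) →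
            (∀ {u} → Bounded (L ℕ.* N) u → u ∈ lows ⊎ u ∈ highs) →
            Cut L lows highs q ρ → Cut L lows highs q′ σ → ρ [ N , M ]⟶ σ →
            ∀ {a} → Bounded N a → Pos (a ∙ (q ∷ ρ)) → Pos (a ∙ (q′ ∷ σ))
  cut-pos _ _ _ _ ρ⟶σ {(+ 0) ∷ a} (_ ∷ a≤N) = 
    Pos-resp (≈-sym (+-identityˡ _)) ∘ pos ρ⟶σ a≤N ∘ Pos-resp (+-identityˡ _)
  cut-pos {L = L} {N} {lows = lows} {highs} {ρ} {σ} {q} {q′}
    e∣L cover C C′ _ {(+ suc e) ∷ a} (e≤N ∷ a≤N) with e∣L e≤N
  ... | ℕ.divides k refl = λ x>0 → proj₂ (Pos-•-⇔ k (scaled σ q′))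
      (transfer (cover (Bounded-scale {c = ℤ.- (+ k)} k≤L a≤N)) (proj₁ (Pos-•-⇔ k (scaled ρ q)) x>0))
    where
    instance k≢0 = ℕ.m*n≢0⇒m≢0 k
    k≤L : ∣ ℤ.- (+ k) ∣ ≤ L
    k≤L = subst (_≤ L) (sym (ℤ.∣-i∣≡∣i∣ (+ k))) (ℕ.m≤m*n k (suc e))
    u = map (ℤ.- (+ k) ℤ.*_) a
    scaled : ∀ ρ q → (+ k) • ((+ suc e) • q + a ∙ ρ) ≈ (+ L) • q + - (u ∙ ρ)
    scaled ρ q = ≈-trans
      (prove (+ k ∷ + suc e ∷ []) (q ∷ a ∙ ρ ∷ []) (a₀ ⊙ (a₁ ⊙ x₀ ⊕ x₁)) ((a₀ :* a₁) ⊙ x₀ ⊝ (:- a₀) ⊙ x₁) refl)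
      (+-cong (•-congʳ q (sym (ℤ.pos-* k (suc e)))) (-‿cong (≈-sym (scale-∙ (ℤ.- (+ k)) a ρ))))
    transfer : u ∈ lows ⊎ u ∈ highs → u ∙ ρ ≺ (+ L) • q → u ∙ σ ≺ (+ L) • q′
    transfer (inj₁ u∈) _   = All.lookup (Cut.below C′) u∈
    transfer (inj₂ u∈) u<q = contradiction (All.lookup (Cut.above C) u∈) (≺-asym u<q)
  -- For a coefficient -e the sign is that of u ρ - L q with u = (L / e) a, so the two sides of the
  -- cut exchange roles.
  cut-pos {L = L} {N} {lows = lows} {highs} {ρ} {σ} {q} {q′}
    e∣L cover C C′ _ { -[1+ e ] ∷ a} (e≤N ∷ a≤N) with e∣L e≤N
  ... | ℕ.divides k refl = λ x>0 → proj₂ (Pos-•-⇔ k (scaled σ q′))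
      (transfer (cover (Bounded-scale {c = + k} (ℕ.m≤m*n k (suc e)) a≤N)) (proj₁ (Pos-•-⇔ k (scaled ρ q)) x>0))
    where
    instance k≢0 = ℕ.m*n≢0⇒m≢0 k
    u = map ((+ k) ℤ.*_) a
    scaled : ∀ ρ q → (+ k) • (-[1+ e ] • q + a ∙ ρ) ≈ u ∙ ρ + - ((+ L) • q)
    scaled ρ q = ≈-trans
      (prove (+ k ∷ + suc e ∷ []) (q ∷ a ∙ ρ ∷ []) (a₀ ⊙ ((:- a₁) ⊙ x₀ ⊕ x₁)) (a₀ ⊙ x₁ ⊝ (a₀ :* a₁) ⊙ x₀) refl)
      (+-cong (≈-sym (scale-∙ (+ k) a ρ)) (-‿cong (•-congʳ q (sym (ℤ.pos-* k (suc e))))))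
    transfer : u ∈ lows ⊎ u ∈ highs → (+ L) • q ≺ u ∙ ρ → (+ L) • q′ ≺ u ∙ σ
    transfer (inj₂ u∈) _   = All.lookup (Cut.above C′) u∈
    transfer (inj₁ u∈) q<u = contradiction (All.lookup (Cut.below C) u∈) (≺-asym q<u)

  residue quot : ∀ m .{{_ : NonZero m}} → Vec ℤ n → Vec ℤ n
  residue m = map (λ x → + (x ℤ.%ℕ m))
  quot    m = map (ℤ._/ℕ m)

  residue-∙ : ∀ m .{{_ : NonZero m}} (u : Vec ℤ n) ρ →
              u ∙ ρ ≈ residue m u ∙ ρ + (+ m) • (quot m u ∙ ρ)
  residue-∙ m []      []      = prove (+ m ∷ []) [] 𝟘 (𝟘 ⊕ a₀ ⊙ 𝟘) refl
  residue-∙ m (a ∷ u) (x ∷ ρ) = ≈-trans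
    (+-cong (•-congʳ x (ℤ.a≡a%ℕn+[a/ℕn]*n a m)) (residue-∙ m u ρ))
    (prove (+ (a ℤ.%ℕ m) ∷ a ℤ./ℕ m ∷ + m ∷ []) (x ∷ residue m u ∙ ρ ∷ quot m u ∙ ρ ∷ [])
      ((a₀ :+ a₁ :* a₂) ⊙ x₀ ⊕ (x₁ ⊕ a₂ ⊙ x₂)) ((a₀ ⊙ x₀ ⊕ x₁) ⊕ a₂ ⊙ (a₁ ⊙ x₀ ⊕ x₂)) refl)

  Bounded-residue : ∀ m .{{_ : NonZero m}} (u : Vec ℤ n) → Bounded m (residue m u)
  Bounded-residue m []      = []
  Bounded-residue m (a ∷ u) = ℕ.<⇒≤ (ℤ.n%ℕd<d a m) ∷ Bounded-residue m u

  Bounded-zeros : ∀ {b} n → Bounded b (replicate n 0ℤ)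
  Bounded-zeros zero    = []
  Bounded-zeros (suc n) = ℕ.z≤n ∷ Bounded-zeros n

  -- The d with M ∣ d q - b ρ for some b form an ideal of ℤ containing M.

  coset-exists : ∀ M .{{_ : NonZero M}} q (ρ : Vec G n) →
                 ∃[ d ] ∃[ b ] b ∈ box M n × Coset M d b q ρ
  coset-exists {n} M@(suc M-1) q ρ =
    let d , Rd , none     = least Related? M-1 relatedM
        b , b∈ , relation = find Rd
    in  suc d , b , b∈ , record { relation = relation ; minimal = minimal d none b relation }
    where
    -- The index is shifted by one so that the least member found is positive. Searching b in the
    -- box suffices, because b matters modulo M.
    Related : ℕ → Set
    Related d = Any.Any (λ b → Divisible M ((+ suc d) • q + - (b ∙ ρ))) (box M n)
    Related? : Decidable Related
    Related? d = Any.any? (λ b → divisible? M _) (box M n)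
    relatedM : Related M-1
    relatedM = lose (∈-box⁺ (Bounded-zeros n)) (q , ≈-trans (≈-sym (+-identityʳ _))
      (+-congˡ (≈-trans (prove [] [] 𝟘 (𝟘 ⊝ 𝟘) refl)
        (≈-trans (+-identityˡ _) (-‿cong (≈-sym (zeros-∙ ρ)))))))
    minimal : ∀ d → (∀ {c} → c < d → ¬ Related c) → ∀ b → Divisible M ((+ suc d) • q + - (b ∙ ρ)) →
              ∀ c a → Divisible M (c • q + a ∙ ρ) → (+ suc d) ℤ.∣ c
    minimal d none b rel c a M∣cq+aρ
      with c ℤ.%ℕ suc d | ℤ.n%ℕd<d c (suc d) | ℤ.a≡a%ℕn+[a/ℕn]*n c (suc d)
    ... | zero  | _       | c≡ = divides (c ℤ./ℕ suc d) (trans c≡ (ℤ.+-identityˡ _))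
    -- A nonzero remainder of c would be a smaller positive member of the ideal, with coefficients
    -- reduced modulo M.
    ... | suc r | s≤s r<d | c≡ = contradiction (lose (∈-box⁺ (Bounded-residue M u)) smaller-relation) (none r<d)
      where
      k = c ℤ./ℕ suc d
      u = lin -1ℤ a (ℤ.- k) b
      R = residue M u ∙ ρ
      T = quot M u ∙ ρ
      regroup : (c • q + a ∙ ρ) + (ℤ.- k) • ((+ suc d) • q + - (b ∙ ρ)) + (+ M) • T ≈
                (+ suc r) • q + - R
      regroup = ≈-trans (+-congʳ (+-congʳ (+-congʳ (•-congʳ q c≡)))) (≈-trans
        (prove (+ suc r ∷ k ∷ + suc d ∷ []) (q ∷ a ∙ ρ ∷ b ∙ ρ ∷ (+ M) • T ∷ [])
          (((a₀ :+ a₁ :* a₂) ⊙ x₀ ⊕ x₁) ⊕ (:- a₁) ⊙ (a₂ ⊙ x₀ ⊝ x₂) ⊕ x₃)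
          (a₀ ⊙ x₀ ⊝ ((con -1ℤ ⊙ x₁ ⊕ (:- a₁) ⊙ x₂) ⊝ x₃)) refl)
        (+-congˡ (-‿cong (≈-trans (+-congʳ (≈-trans (≈-sym (lin-∙ -1ℤ a (ℤ.- k) b ρ)) (residue-∙ M u ρ)))
          (prove [] (R ∷ (+ M) • T ∷ []) ((x₀ ⊕ x₁) ⊝ x₁) x₀ refl)))))
      smaller-relation : Divisible M ((+ suc r) • q + - R)
      smaller-relation = Divisible-resp regroup
        (Divisible-+ (Divisible-+ M∣cq+aρ (Divisible-• (ℤ.- k) rel)) (Divisible-multiple T))

  -- Minimality is applied to the trivial congruence M ∣ M q.
  Coset-∣ : ∀ {M d b q} {ρ : Vec G n} → Coset M d b q ρ → d ℕ.∣ M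
  Coset-∣ {n} {M} {q = q} {ρ} C = ℤ.∣⇒∣ᵤ (Coset.minimal C (+ M) (replicate n 0ℤ)
    (q , ≈-trans (≈-sym (+-identityʳ _)) (+-congˡ (≈-sym (zeros-∙ ρ)))))

  -- As d ∣ M, the coset relation also holds modulo d, where d q vanishes. The result no longer
  -- mentions q and can therefore be transferred to σ.
  Coset-root : ∀ {M d b q} {ρ : Vec G n} → Coset M d b q ρ → Divisible d (b ∙ ρ)
  Coset-root {d = d} {b} {q} {ρ} C = Divisible-resp
    (prove (+ d ∷ []) (q ∷ b ∙ ρ ∷ []) (a₀ ⊙ x₀ ⊕ con -1ℤ ⊙ (a₀ ⊙ x₀ ⊝ x₁)) x₁ refl)
    (Divisible-+ (Divisible-multiple q) (Divisible-• -1ℤ (Divisible-∣ (Coset-∣ C) (Coset.relation C))))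

  -- Any y + (M / d) z + M r with d y = b σ and z generic over y and σ lies in the coset,
  -- and r is free to place it in the cut.

  coset-cut : ∀ L .{{_ : NonZero L}} M .{{_ : NonZero M}} d b (σ : Vec G n) lows highs →
              d ℕ.∣ M → Divisible d (b ∙ σ) → Separated lows highs σ →
              ∃[ q ] Coset M d b q σ × Cut L lows highs q σ
  coset-cut L M d b σ lows highs (ℕ.divides k refl) (y , dy≈bσ) separated =
    q , record { relation = relation ; minimal = minimal } , record
      { below = All.map (≺-resp ≈-refl (≈-sym Lq≈)) (All.map⁻ below)
      ; above = All.map (≺-resp (≈-sym Lq≈) ≈-refl) (All.map⁻ above) }
    where
    instance
      LM≢0 = ℕ.m*n≢0 L M
      k≢0 = ℕ.m*n≢0⇒m≢0 k
    z = proj₁ (generic M (y ∷ σ))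
    base = y + (+ k) • z
    interval : Σ[ r ∈ G ] All (_≺ (+ L) • base + (+ (L ℕ.* M)) • r) (List.map (_∙ σ) lows) ×
                          All ((+ L) • base + (+ (L ℕ.* M)) • r ≺_) (List.map (_∙ σ) highs)
    interval = between (L ℕ.* M) ((+ L) • base) (List.map (_∙ σ) lows) (List.map (_∙ σ) highs)
      (All.map⁺ (All.map All.map⁺ separated))
    r = proj₁ interval
    below = proj₁ (proj₂ interval)
    above = proj₂ (proj₂ interval)
    q = base + (+ M) • r
    Lq≈ : (+ L) • q ≈ (+ L) • base + (+ (L ℕ.* M)) • r
    Lq≈ = ≈-trans (prove (+ L ∷ + M ∷ []) (base ∷ r ∷ []) (a₀ ⊙ (x₀ ⊕ a₁ ⊙ x₁)) (a₀ ⊙ x₀ ⊕ (a₀ :* a₁) ⊙ x₁) refl)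
      (+-congˡ (•-congʳ r (sym (ℤ.pos-* L M))))
    M≡kd = ℤ.pos-* k d
    relation : Divisible M ((+ d) • q + - (b ∙ σ))
    relation = z + (+ d) • r , ≈-trans (•-congʳ _ M≡kd) (≈-trans
      (prove (+ k ∷ + d ∷ []) (y ∷ z ∷ r ∷ [])
        ((a₀ :* a₁) ⊙ (x₁ ⊕ a₁ ⊙ x₂)) (a₁ ⊙ (x₀ ⊕ a₀ ⊙ x₁ ⊕ (a₀ :* a₁) ⊙ x₂) ⊝ a₁ ⊙ x₀) refl)
      (+-cong (•-congˡ (+ d) (+-congˡ (•-congʳ r (sym M≡kd)))) (-‿cong dy≈bσ)))
    minimal : ∀ c a → Divisible M (c • q + a ∙ σ) → (+ d) ℤ.∣ c
    -- Modulo M, c q + a σ is k c z + (c y + a σ). Genericity over y and σ gives M = k d ∣ k c, and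
    -- k cancels.
    minimal c a M∣cq+aσ = ℤ.*-cancelˡ-∣ (+ k) (subst (ℤ._∣ + k ℤ.* c) M≡kd
      (proj₂ (generic M (y ∷ σ)) (+ k ℤ.* c) (c ∷ a) (Divisible-resp
        (prove (c ∷ + k ∷ + M ∷ []) (y ∷ z ∷ r ∷ a ∙ σ ∷ [])
          ((a₀ ⊙ (x₀ ⊕ a₁ ⊙ x₁ ⊕ a₂ ⊙ x₂) ⊕ x₃) ⊕ a₂ ⊙ ((:- a₀) ⊙ x₂)) ((a₁ :* a₀) ⊙ x₁ ⊕ (a₀ ⊙ x₀ ⊕ x₃)) refl)
        (Divisible-+ M∣cq+aσ (Divisible-multiple ((ℤ.- c) • r))))))

  _[_,_]⟷_ : Vec G n → ℕ → ℕ → Vec G n → Set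
  ρ [ N , M ]⟷ σ = ρ [ N , M ]⟶ σ × σ [ N , M ]⟶ ρ

  ⟷-refl : ∀ {N M} {ρ : Vec G n} → ρ [ N , M ]⟷ ρ
  ⟷-refl = record { pos = λ _ p → p ; dvd = λ _ d → d } , record { pos = λ _ p → p ; dvd = λ _ d → d }

  ⟷-sym : ∀ {N M} {ρ σ : Vec G n} → ρ [ N , M ]⟷ σ → σ [ N , M ]⟷ ρ
  ⟷-sym (f , g) = g , f

  ⟷-mono : ∀ {N N′ M M′} .{{_ : NonZero M′}} {ρ σ : Vec G n} → N ≤ N′ → M ℕ.∣ M′ →
           ρ [ N′ , M′ ]⟷ σ → ρ [ N , M ]⟷ σ
  ⟷-mono N≤N′ M∣M′ (f , g) = mono N≤N′ M∣M′ f , mono N≤N′ M∣M′ g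

  module Extension (N M : ℕ) .{{_ : NonZero M}} where

    -- The summands of N′ serve, in order, the combinations of ρ alone in the cut case, the
    -- combinations L b + e u of `root-step`, and the differences v - u that separate the sides of a
    -- cut. M′ accommodates both multiplication by L and divisibility by L.
    L B N′ M′ : ℕ
    L  = N !
    B  = L ℕ.* N
    N′ = N ℕ.+ (L ℕ.* N ℕ.+ N ℕ.* B) ℕ.+ (1 ℕ.* B ℕ.+ 1 ℕ.* B)
    M′ = L ℕ.* M

    instance
      L≢0 : NonZero L
      L≢0 = N ℕ.!≢0
      M′≢0 : NonZero M′
      M′≢0 = ℕ.m*n≢0 L M

    divides-L : ∀ {e} → suc e ≤ N → suc e ℕ.∣ L
    divides-L {e} e<N = ℕ.∣-trans (ℕ.m∣m*n (e !)) (ℕ.m≤n⇒m!∣n! e<N)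

    module _ {n} (σ : Vec G n) where

      Code : Set
      Code = ℕ × Vec ℤ n × List (Vec ℤ n) × List (Vec ℤ n)

      -- Decidable conditions on σ alone. They suffice for a realisation by `coset-cut`, and hold
      -- for every code read off from an extension of a tuple equivalent to σ.
      Admissible : Code → Set
      Admissible (d , b , lows , highs) = d ℕ.∣ M × Divisible d (b ∙ σ) × Separated lows highs σ

      admissible? : ∀ c → Dec (Admissible c)
      admissible? (d , b , lows , highs) with d ℕ.∣? M
      ... | no d∤M  = no (d∤M ∘ proj₁)
      ... | yes d∣M = map′ (d∣M ,_) proj₂
        (divisible? d (b ∙ σ) ×-dec All.all? (λ u → All.all? (λ v → u ∙ σ ≺? v ∙ σ) highs) lows)
        where instance d≢0 : NonZero d
                       d≢0 = ℕ.≢-nonZero λ { refl → ℕ.≢-nonZero⁻¹ M (ℕ.0∣⇒≡0 d∣M) }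

      roots = collect {H = λ u → Divisible L (u ∙ σ)} {Q = λ u q → (+ L) • q ≈ u ∙ σ}
        (λ u → singletonIf (divisible? L (u ∙ σ)) λ (q , eq) → q , eq) (box B n)

      cuts = collect {H = Admissible}
        {Q = λ (d , b , lows , highs) q → Coset M d b q σ × Cut L lows highs q σ}
        (λ c@(d , b , lows , highs) → singletonIf (admissible? c)
          λ (d∣M , b/d , sep) → coset-cut L M d b σ lows highs d∣M b/d sep)
        (cartesianProduct (upTo (suc M)) (cartesianProduct (box M n) (splits (box B n))))

      candidates : List G
      candidates = proj₁ roots ++ proj₁ cuts

      -- In the root case q itself witnesses L ∣ u ρ, which transfers to σ. Otherwise the code of q
      -- transfers: d ∣ b ρ is a divisibility, and u ρ ≺ v ρ is positivity of the combination v - u.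
      extends : ∀ {ρ} q → ρ [ N′ , M′ ]⟷ σ → ∃[ q′ ] q′ ∈ candidates × (q ∷ ρ) [ N , M ]⟷ (q′ ∷ σ)
      extends {ρ} q (ρ⟶σ , σ⟶ρ) with Any.any? (λ u → ≈? ((+ L) • q) (u ∙ ρ)) (box B n)
        where
        ≈? : ∀ x y → Dec (x ≈ y)
        ≈? x y with compare x y
        ... | inj₁ x≺y        = no λ x≈y → ≺-asym x≺y (≺-resp x≈y (≈-sym x≈y) x≺y)
        ... | inj₂ (inj₁ x≈y) = yes x≈y
        ... | inj₂ (inj₂ y≺x) = no λ x≈y → ≺-asym y≺x (≺-resp (≈-sym x≈y) x≈y y≺x)
      ... | yes atRoot =
        let u , u∈ , Lq≈uρ   = find atRoot
            q′ , q′∈ , Lq′≈uσ = proj₂ roots u∈ (dvd-∣ ρ⟶σ (ℕ.m∣m*n M) u (q , Lq≈uρ))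
            u≤B              = ∈-box⁻ u∈
            restrict : ∀ {ρ σ : Vec G n} → ρ [ N′ , M′ ]⟶ σ → ρ [ L ℕ.* N ℕ.+ N ℕ.* B , M′ ]⟶ σ
            restrict         = mono (ℕ.≤-trans (ℕ.m≤n+m _ N) (ℕ.m≤m+n _ _)) ℕ.∣-refl
        in  q′ , ∈-++⁺ˡ q′∈ ,
            root-step {L = L} u≤B Lq≈uρ Lq′≈uσ (restrict ρ⟶σ) ,
            root-step {L = L} u≤B Lq′≈uσ Lq≈uρ (restrict σ⟶ρ)
      ... | no notRoot =
        let d , b , b∈ , C = coset-exists M q ρ
            (lows , highs) , s∈ , ls , hs , cover = splits-complete (box B n) side
            d∣M = Coset-∣ C
            q′ , q′∈ , C′ , K′ = proj₂ cuts
              (∈-cartesianProduct⁺ (∈-upTo⁺ (s≤s (ℕ.∣⇒≤ d∣M))) (∈-cartesianProduct⁺ b∈ s∈))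
              ( d∣M
              , dvd-∣ ρ⟶σ (ℕ.∣-trans d∣M (ℕ.n∣m*n L)) b (Coset-root C)
              , All.map (λ u → All.map (separate u) hs) ls)
            K = record { below = All.map proj₂ ls ; above = All.map proj₂ hs }
            cover′ = λ {u} (u≤B : Bounded B u) → cover (∈-box⁺ u≤B)
            M∣M′ = ℕ.n∣m*n L
        in  q′ , ∈-++⁺ʳ (proj₁ roots) q′∈ ,
            record { pos = cut-pos divides-L cover′ K K′ (restrict ρ⟶σ) ; dvd = coset-dvd C C′ M∣M′ ρ⟶σ } ,
            record { pos = cut-pos divides-L cover′ K′ K (restrict σ⟶ρ) ; dvd = coset-dvd C′ C M∣M′ σ⟶ρ }
        where
        side : ∀ {u} → u ∈ box B n → (Bounded B u × u ∙ ρ ≺ (+ L) • q) ⊎ (Bounded B u × (+ L) • q ≺ u ∙ ρ)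
        side {u} u∈ with compare (u ∙ ρ) ((+ L) • q)
        ... | inj₁ u<q        = inj₁ (∈-box⁻ u∈ , u<q)
        ... | inj₂ (inj₁ u≈q) = contradiction (lose u∈ (≈-sym u≈q)) notRoot
        ... | inj₂ (inj₂ q<u) = inj₂ (∈-box⁻ u∈ , q<u)
        separate : ∀ {u v} → Bounded B u × u ∙ ρ ≺ (+ L) • q → Bounded B v × (+ L) • q ≺ v ∙ ρ → u ∙ σ ≺ v ∙ σ
        separate {u} {v} (u≤B , u<q) (v≤B , q<v) = Pos-resp (difference σ)
          (pos ρ⟶σ (Bounded-mono (ℕ.m≤n+m _ (N ℕ.+ (L ℕ.* N ℕ.+ N ℕ.* B)))
              (Bounded-lin {c = 1ℤ} { -1ℤ} ℕ.≤-refl ℕ.≤-refl v≤B u≤B))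
            (Pos-resp (≈-sym (difference ρ)) (≺-trans u<q q<v)))
          where
          difference : ∀ τ → lin 1ℤ v -1ℤ u ∙ τ ≈ v ∙ τ + - (u ∙ τ)
          difference τ = ≈-trans (lin-∙ 1ℤ v -1ℤ u τ)
            (prove [] (u ∙ τ ∷ v ∙ τ ∷ []) (con 1ℤ ⊙ x₁ ⊕ con -1ℤ ⊙ x₀) (x₁ ⊝ x₀) refl)
        restrict : ∀ {ρ σ : Vec G n} → ρ [ N′ , M′ ]⟶ σ → ρ [ N , M′ ]⟶ σ
        restrict = mono (ℕ.≤-trans (ℕ.m≤m+n N _) (ℕ.m≤m+n _ _)) ℕ.∣-refl

-- Arithmetic of powers and primes in ℕ.

*-^-distrib : ∀ m n k → (m ℕ.* n) ^ k ≡ m ^ k ℕ.* n ^ k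
*-^-distrib m n zero    = refl
*-^-distrib m n (suc k) = trans (cong (m ℕ.* n ℕ.*_) (*-^-distrib m n k)) (interchange m n (m ^ k) (n ^ k))
  where
  interchange : ∀ m n p q → m ℕ.* n ℕ.* (p ℕ.* q) ≡ m ℕ.* p ℕ.* (n ℕ.* q)
  interchange = solve-∀

coprime-^ : ∀ {m n} k → Coprime m n → Coprime m (n ^ k)
coprime-^ zero    c (_ , i∣1) = ℕ.∣1⇒≡1 i∣1
coprime-^ {m} {n} (suc k) c {i} (i∣m , i∣nnᵏ) = coprime-^ k c (i∣m , ℕ.coprime-divisor coprime-i i∣nnᵏ)
  where
  coprime-i : Coprime i n
  coprime-i (j∣i , j∣n) = c (ℕ.∣-trans j∣i i∣m , j∣n)

-- Division by the gcd leaves coprime m′ and n′ with m′ᵏ ∣ n′ᵏ. Then m′ is coprime to n′ᵏ and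
-- divides it, so m′ = 1.
^-cancel-∣ : ∀ k .{{_ : NonZero k}} m .{{_ : NonZero m}} n → m ^ k ℕ.∣ n ^ k → m ℕ.∣ n
^-cancel-∣ k@(suc k-1) m n mᵏ∣nᵏ = subst (ℕ._∣ n) (sym m≡g) (ℕ.gcd[m,n]∣n m n)
  where
  open ≡-Reasoning
  g = ℕ.gcd m n
  instance
    g≢0 : NonZero g
    g≢0 = ℕ.≢-nonZero (ℕ.gcd[m,n]≢0 m n (inj₁ (ℕ.≢-nonZero⁻¹ m)))
    gᵏ≢0 : NonZero (g ^ k)
    gᵏ≢0 = ℕ.m^n≢0 g k
  m′ = m ℕ./ g
  n′ = n ℕ./ g
  m≡ : m ≡ m′ ℕ.* g
  m≡ = sym (ℕ.m/n*n≡m (ℕ.gcd[m,n]∣m m n))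
  n≡ : n ≡ n′ ℕ.* g
  n≡ = sym (ℕ.m/n*n≡m (ℕ.gcd[m,n]∣n m n))
  power : ∀ a b → a ≡ b ℕ.* g → a ^ k ≡ b ^ k ℕ.* g ^ k
  power _ b refl = *-^-distrib b g k
  m′ᵏ∣n′ᵏ : m′ ^ k ℕ.∣ n′ ^ k
  m′ᵏ∣n′ᵏ = ℕ.*-cancelʳ-∣ (g ^ k) (subst (ℕ._∣ n′ ^ k ℕ.* g ^ k) (power m m′ m≡)
    (subst (m ^ k ℕ.∣_) (power n n′ n≡) mᵏ∣nᵏ))
  m′≡1 : m′ ≡ 1
  m′≡1 = coprime-^ k (ℕ.coprime-/gcd m n) (ℕ.∣-refl , ℕ.∣-trans (ℕ.m∣m*n (m′ ^ k-1)) m′ᵏ∣n′ᵏ)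
  m≡g : m ≡ g
  m≡g = trans m≡ (trans (cong (ℕ._* g) m′≡1) (ℕ.*-identityˡ g))

-- Bernoulli's inequality 1 + n / f ≤ (1 + 1 / f)ⁿ, cleared of denominators.
bernoulli : ∀ f n → (f ℕ.+ n) ℕ.* f ^ n ≤ f ℕ.* suc f ^ n
bernoulli f zero    = ℕ.≤-reflexive (cong (ℕ._* 1) (ℕ.+-identityʳ f))
bernoulli f (suc n) = begin
  (f ℕ.+ suc n) ℕ.* (f ℕ.* f ^ n)                     ≤⟨ ℕ.m≤m+n _ (n ℕ.* f ^ n) ⟩
  (f ℕ.+ suc n) ℕ.* (f ℕ.* f ^ n) ℕ.+ n ℕ.* f ^ n     ≡⟨ expand f n (f ^ n) ⟩
  suc f ℕ.* ((f ℕ.+ n) ℕ.* f ^ n)                     ≤⟨ ℕ.*-monoʳ-≤ (suc f) (bernoulli f n) ⟩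
  suc f ℕ.* (f ℕ.* suc f ^ n)                         ≡⟨ swap f (suc f ^ n) ⟩
  f ℕ.* (suc f ℕ.* suc f ^ n)                         ∎
  where
  open ℕ.≤-Reasoning
  expand : ∀ f n p → (f ℕ.+ suc n) ℕ.* (f ℕ.* p) ℕ.+ n ℕ.* p ≡ suc f ℕ.* ((f ℕ.+ n) ℕ.* p)
  expand = solve-∀
  swap : ∀ f p → suc f ℕ.* (f ℕ.* p) ≡ f ℕ.* (suc f ℕ.* p)
  swap = solve-∀

primeDivisor : ∀ n → ∃[ p ] Prime p × p ℕ.∣ suc (suc n)
primeDivisor n with factorise (suc (suc n))
... | record { factors = [] ; isFactorisation = () }
... | record { factors = p ∷ ps ; isFactorisation = eq ; factorsPrime = pp ∷ _ } =
  p , pp , ℕ.∣-trans (ℕ.m∣m*n _) (ℕ.∣-reflexive (sym eq))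

prime∤1 : ∀ {p} → Prime p → ¬ p ℕ.∣ 1
prime∤1 pp p∣1 with ℕ.∣1⇒≡1 p∣1
... | refl with () ← prime⇒nonTrivial pp

-- Euclid's argument: a prime divisor of n! + 1 that is at most n would divide n! and hence 1.
primeAbove : ∀ n → ∃[ p ] Prime p × n < p
primeAbove n with n ! in eq | primeDivisor (ℕ.pred (n !))
... | zero  | _ = contradiction eq (ℕ.≢-nonZero⁻¹ (n !) {{n ℕ.!≢0}})
... | suc k | p , pp , p∣1+n! = p , pp , ℕ.≰⇒> λ p≤n → prime∤1 pp
  (ℕ.∣m+n∣m⇒∣n (subst (p ℕ.∣_) (ℕ.+-comm 1 (suc k)) p∣1+n!)
    (subst (p ℕ.∣_) eq (ℕ.∣-trans (p∣p! p {{prime⇒nonZero pp}}) (ℕ.m≤n⇒m!∣n! p≤n))))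
  where
  p∣p! : ∀ p .{{_ : NonZero p}} → p ℕ.∣ p !
  p∣p! (suc p) = ℕ.m∣m*n (p !)

padic : ∀ {p} → Prime p → ∀ n .{{_ : NonZero n}} → ∃[ k ] ∃[ u ] n ≡ p ^ k ℕ.* u × ¬ p ℕ.∣ u
padic {p} pp = <-rec (λ n → .{{NonZero n}} → ∃[ k ] ∃[ u ] n ≡ p ^ k ℕ.* u × ¬ p ℕ.∣ u) step
  where
  step : ∀ n → (∀ {m} → m < n → .{{NonZero m}} → ∃[ k ] ∃[ u ] m ≡ p ^ k ℕ.* u × ¬ p ℕ.∣ u) →
         .{{NonZero n}} → ∃[ k ] ∃[ u ] n ≡ p ^ k ℕ.* u × ¬ p ℕ.∣ u
  step n rec with p ℕ.∣? n
  ... | no p∤n = 0 , n , sym (ℕ.*-identityˡ n) , p∤n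
  ... | yes (ℕ.divides m refl)
    with rec (ℕ.m<m*n m p {{ℕ.m*n≢0⇒m≢0 m}} (ℕ.nonTrivial⇒n>1 p {{prime⇒nonTrivial pp}}))
           {{ℕ.m*n≢0⇒m≢0 m}}
  ... | k , u , refl , p∤u = suc k , u , rotate (p ^ k) u p , p∤u
    where
    rotate : ∀ q u p → q ℕ.* u ℕ.* p ≡ p ℕ.* q ℕ.* u
    rotate = solve-∀

-- The multiplicative group of positive rationals.

record Fraction : Set where
  constructor _÷_
  field
    num den       : ℕ
    {{.num≢0}}    : NonZero num
    {{.den≢0}}    : NonZero den

open Fraction

infix  4 _≃_
infixl 6 _⊗_
infix  8 _⁻¹

-- Fractions stay unreduced, so that products and powers act on numerator and denominator
-- separately; equality is by cross multiplication.
record _≃_ (x y : Fraction) : Set where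
  constructor cross
  field equal : num x ℕ.* den y ≡ num y ℕ.* den x

_⊗_ : Fraction → Fraction → Fraction
(a ÷ b) ⊗ (c ÷ d) = _÷_ (a ℕ.* c) (b ℕ.* d) {{ℕ.m*n≢0 a c}} {{ℕ.m*n≢0 b d}}

_⁻¹ : Fraction → Fraction
(a ÷ b) ⁻¹ = b ÷ a

1/1 : Fraction
1/1 = 1 ÷ 1

≃-trans : ∀ {x y z} → x ≃ y → y ≃ z → x ≃ z
≃-trans {a ÷ b} {c ÷ d} {e ÷ f} (cross ad≡cb) (cross cf≡ed) = cross (ℕ.*-cancelʳ-≡ (a ℕ.* f) (e ℕ.* b) d (begin
  a ℕ.* f ℕ.* d   ≡⟨ swap a f d ⟩
  a ℕ.* d ℕ.* f   ≡⟨ cong (ℕ._* f) ad≡cb ⟩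
  c ℕ.* b ℕ.* f   ≡⟨ swap c b f ⟩
  c ℕ.* f ℕ.* b   ≡⟨ cong (ℕ._* b) cf≡ed ⟩
  e ℕ.* d ℕ.* b   ≡⟨ swap e d b ⟩
  e ℕ.* b ℕ.* d   ∎))
  where
  open ≡-Reasoning
  swap : ∀ x y z → x ℕ.* y ℕ.* z ≡ x ℕ.* z ℕ.* y
  swap = solve-∀

⊗-cong : ∀ {x x′ y y′} → x ≃ x′ → y ≃ y′ → x ⊗ y ≃ x′ ⊗ y′
⊗-cong {a ÷ b} {a′ ÷ b′} {c ÷ d} {c′ ÷ d′} (cross p) (cross q) =
  cross (trans (interchange a c b′ d′) (trans (cong₂ ℕ._*_ p q) (interchange a′ b c′ d)))
  where
  interchange : ∀ a b c d → a ℕ.* b ℕ.* (c ℕ.* d) ≡ a ℕ.* c ℕ.* (b ℕ.* d)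
  interchange = solve-∀

⁻¹-cong : ∀ {x y} → x ≃ y → x ⁻¹ ≃ y ⁻¹
⁻¹-cong {a ÷ b} {c ÷ d} (cross p) = cross (trans (ℕ.*-comm b c) (trans (sym p) (ℕ.*-comm a d)))

ℚ⁺ : AbelianGroup 0ℓ 0ℓ
ℚ⁺ = record
  { Carrier = Fraction ; _≈_ = _≃_ ; _∙_ = _⊗_ ; ε = 1/1 ; _⁻¹ = _⁻¹
  ; isAbelianGroup = record
    { isGroup = record
      { isMonoid = record
        { isSemigroup = record
          { isMagma = record
            { isEquivalence = record
              { refl = cross refl ; sym = λ (cross p) → cross (sym p) ; trans = ≃-trans }
            ; ∙-cong = ⊗-cong }
          ; assoc = λ { (a ÷ b) (c ÷ d) (e ÷ f) → cross (assoc a b c d e f) } }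
        ; identity = (λ { (a ÷ b) → cross (identityˡ a b) }) , (λ { (a ÷ b) → cross (identityʳ a b) }) }
      ; inverse = (λ { (a ÷ b) → cross (inverse b a) }) , (λ { (a ÷ b) → cross (inverse a b) })
      ; ⁻¹-cong = ⁻¹-cong }
    ; comm = λ { (a ÷ b) (c ÷ d) → cross (comm a b c d) } }
  }
  where
  assoc : ∀ a b c d e f → a ℕ.* c ℕ.* e ℕ.* (b ℕ.* (d ℕ.* f)) ≡ a ℕ.* (c ℕ.* e) ℕ.* (b ℕ.* d ℕ.* f)
  assoc = solve-∀
  identityˡ : ∀ a b → 1 ℕ.* a ℕ.* b ≡ a ℕ.* (1 ℕ.* b)
  identityˡ = solve-∀
  identityʳ : ∀ a b → a ℕ.* 1 ℕ.* b ≡ a ℕ.* (b ℕ.* 1)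
  identityʳ = solve-∀
  inverse : ∀ a b → a ℕ.* b ℕ.* 1 ≡ 1 ℕ.* (b ℕ.* a)
  inverse = solve-∀
  comm : ∀ a b c d → a ℕ.* c ℕ.* (d ℕ.* b) ≡ c ℕ.* a ℕ.* (b ℕ.* d)
  comm = solve-∀

open module ℚ⁺-Module = ℤ-Module ℚ⁺ using (_•_; _∙_; Divisible)

num-• : ∀ n x → num ((+ n) • x) ≡ num x ^ n
num-• zero    x = refl
num-• (suc n) x = cong (num x ℕ.*_) (num-• n x)

den-• : ∀ n x → den ((+ n) • x) ≡ den x ^ n
den-• zero    x = refl
den-• (suc n) x = cong (den x ℕ.*_) (den-• n x)

-- The positive cone: the zero of the additive notation is `1/1`.
Above1 : Fraction → Set
Above1 x = den x < num x

Above1-resp : ∀ {x y} → x ≃ y → Above1 x → Above1 y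
Above1-resp {a ÷ b} {c ÷ d} (cross ad≡cb) b<a =
  ℕ.*-cancelʳ-< b d c (subst (d ℕ.* b <_) (trans (ℕ.*-comm d a) ad≡cb) (ℕ.*-monoʳ-< d b<a))

Above1-⊗ : ∀ {x y} → Above1 x → Above1 y → Above1 (x ⊗ y)
Above1-⊗ = ℕ.*-mono-<

Above1-trichotomy : ∀ x → Above1 x ⊎ x ≃ 1/1 ⊎ Above1 (x ⁻¹)
Above1-trichotomy (a ÷ b) with ℕ.<-cmp a b
... | tri< a<b _ _ = inj₂ (inj₂ a<b)
... | tri≈ _ a≡b _ = inj₂ (inj₁ (cross (trans (ℕ.*-identityʳ a) (trans a≡b (sym (ℕ.*-identityˡ b))))))
... | tri> _ _ b<a = inj₁ b<a

-- ((2 d + 2) / (2 d + 1))² < (d + 1) / d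

Above1-halve : ∀ {x} → Above1 x → Σ[ y ∈ Fraction ] Above1 y × Above1 (x ⊗ ((y ⊗ y) ⁻¹))
Above1-halve {c ÷ d} d<c = suc w ÷ w , ℕ.n<1+n w , (begin-strict
  d ℕ.* (suc w ℕ.* suc w)             <⟨ ℕ.m<m+n _ z<s ⟩
  d ℕ.* (suc w ℕ.* suc w) ℕ.+ suc d   ≡⟨ square d ⟩
  suc d ℕ.* (w ℕ.* w)                 ≤⟨ ℕ.*-monoˡ-≤ (w ℕ.* w) d<c ⟩
  c ℕ.* (w ℕ.* w)                     ∎)
  where
  open ℕ.≤-Reasoning
  w = suc (d ℕ.+ d)
  square : ∀ d → d ℕ.* ((2 ℕ.+ (d ℕ.+ d)) ℕ.* (2 ℕ.+ (d ℕ.+ d))) ℕ.+ suc d ≡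
                 suc d ℕ.* (suc (d ℕ.+ d) ℕ.* suc (d ℕ.+ d))
  square = solve-∀

-- The exponent j = f a comes from Bernoulli's inequality: (e / f)ʲ ≥ (1 + 1 / f)ʲ ≥ 1 + a > a / b.
Above1-archimedean : ∀ {x} → Above1 x → ∀ y → Σ[ n ∈ ℕ ] Above1 ((+ n) • x ⊗ (y ⁻¹))
Above1-archimedean {x@(e ÷ f)} f<e (a ÷ b) = j , (begin-strict
  den ((+ j) • x) ℕ.* a   ≡⟨ cong (ℕ._* a) (den-• j x) ⟩
  f ^ j ℕ.* a             ≡⟨ ℕ.*-comm (f ^ j) a ⟩
  a ℕ.* f ^ j             <⟨ ℕ.m<n+m _ (ℕ.m^n>0 f j) ⟩
  suc a ℕ.* f ^ j         ≤⟨ ℕ.*-cancelˡ-≤ f cancel-f ⟩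
  suc f ^ j               ≤⟨ ℕ.^-monoˡ-≤ j f<e ⟩
  e ^ j                   ≤⟨ ℕ.m≤m*n (e ^ j) b ⟩
  e ^ j ℕ.* b             ≡⟨ cong (ℕ._* b) (num-• j x) ⟨
  num ((+ j) • x) ℕ.* b   ∎)
  where
  open ℕ.≤-Reasoning
  j = f ℕ.* a
  factor : ∀ f a p → f ℕ.* (suc a ℕ.* p) ≡ (f ℕ.+ f ℕ.* a) ℕ.* p
  factor = solve-∀
  cancel-f : f ℕ.* (suc a ℕ.* f ^ j) ≤ f ℕ.* suc f ^ j
  cancel-f = ℕ.≤-trans (ℕ.≤-reflexive (factor f a (f ^ j))) (bernoulli f j)

-- a / b is an m-th power iff the integer a b^(m-1) is.

isPower? : ∀ m .{{_ : NonZero m}} x → Dec (Divisible m x)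
-- An m-th root w of an integer satisfies w ≤ wᵐ, which bounds the search.
isPower? m@(suc k) x@(a ÷ b) with ℕ.anyUpTo? (λ w → w ^ m ℕ.≟ a ℕ.* b ^ k) (suc (a ℕ.* b ^ k))
... | yes (zero , _ , 0≡t) = contradiction (sym 0≡t)
  (ℕ.≢-nonZero⁻¹ (a ℕ.* b ^ k) {{ℕ.m*n≢0 a (b ^ k) {{it}} {{ℕ.m^n≢0 b k}}}})
... | yes (w@(suc _) , _ , wᵐ≡t) = yes ((w ÷ b) ℚ⁺-Module., cross (begin
  num ((+ m) • (w ÷ b)) ℕ.* b   ≡⟨ cong (ℕ._* b) (num-• m (w ÷ b)) ⟩
  w ^ m ℕ.* b                   ≡⟨ cong (ℕ._* b) wᵐ≡t ⟩
  a ℕ.* b ^ k ℕ.* b             ≡⟨ rotate a (b ^ k) b ⟩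
  a ℕ.* b ^ m                   ≡⟨ cong (a ℕ.*_) (den-• m (w ÷ b)) ⟨
  a ℕ.* den ((+ m) • (w ÷ b))   ∎))
  where
  open ≡-Reasoning
  rotate : ∀ a p b → a ℕ.* p ℕ.* b ≡ a ℕ.* (b ℕ.* p)
  rotate = solve-∀
... | no none = no λ (h@(u ÷ v) ℚ⁺-Module., cross eq) → impossible u v
    (trans (cong (ℕ._* b) (sym (num-• m h))) (trans eq (cong (a ℕ.*_) (den-• m h))))
  where
  open ≡-Reasoning
  t = a ℕ.* b ^ k
  rotate : ∀ p b q → p ℕ.* (b ℕ.* q) ≡ p ℕ.* b ℕ.* q
  rotate = solve-∀
  swap : ∀ a p q → a ℕ.* p ℕ.* q ≡ a ℕ.* q ℕ.* p
  swap = solve-∀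
  clear : ∀ u v → u ^ m ℕ.* b ≡ a ℕ.* v ^ m → (u ℕ.* b) ^ m ≡ t ℕ.* v ^ m
  clear u v eq = begin
    (u ℕ.* b) ^ m           ≡⟨ *-^-distrib u b m ⟩
    u ^ m ℕ.* b ^ m         ≡⟨ rotate (u ^ m) b (b ^ k) ⟩
    u ^ m ℕ.* b ℕ.* b ^ k   ≡⟨ cong (ℕ._* b ^ k) eq ⟩
    a ℕ.* v ^ m ℕ.* b ^ k   ≡⟨ swap a (v ^ m) (b ^ k) ⟩
    t ℕ.* v ^ m             ∎
  w≤wᵐ : ∀ w → w ≤ w ^ m
  w≤wᵐ zero      = z≤n
  w≤wᵐ w@(suc _) = ℕ.m≤m*n w (w ^ k) {{ℕ.m^n≢0 w k}}
  impossible : ∀ u v .{{_ : NonZero v}} → ¬ u ^ m ℕ.* b ≡ a ℕ.* v ^ m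
  -- From (u / v)ᵐ = a / b follows (u b)ᵐ = t vᵐ, so v ∣ u b and the quotient is an integral m-th
  -- root of t.
  impossible u v eq with ^-cancel-∣ m v (u ℕ.* b) (ℕ.divides t (clear u v eq))
  ... | ℕ.divides w ub≡wv = none (w , s≤s (subst (w ≤_) wᵐ≡t (w≤wᵐ w)) , wᵐ≡t)
    where
    wᵐ≡t : w ^ m ≡ t
    wᵐ≡t = ℕ.*-cancelʳ-≡ (w ^ m) t (v ^ m) {{ℕ.m^n≢0 v m}}
      (trans (sym (*-^-distrib w v m)) (trans (cong (_^ m) (sym ub≡wv)) (clear u v eq)))

-- Generic elements from primes.

module Valuation (p : ℕ) (p-prime : Prime p) where

  private instance
    p≢0 : NonZero p
    p≢0 = prime⇒nonZero p-prime

  PrimeTo : Fraction → Set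
  PrimeTo x = (¬ p ℕ.∣ num x) × (¬ p ℕ.∣ den x)

  ∤-* : ∀ {a b} → ¬ p ℕ.∣ a → ¬ p ℕ.∣ b → ¬ p ℕ.∣ a ℕ.* b
  ∤-* {a} {b} p∤a p∤b p∣ab with euclidsLemma a b p-prime p∣ab
  ... | inj₁ p∣a = p∤a p∣a
  ... | inj₂ p∣b = p∤b p∣b

  PrimeTo-1/1 : PrimeTo 1/1
  PrimeTo-1/1 = prime∤1 p-prime , prime∤1 p-prime

  PrimeTo-⊗ : ∀ x y → PrimeTo x → PrimeTo y → PrimeTo (x ⊗ y)
  PrimeTo-⊗ _ _ (p∤a , p∤b) (p∤c , p∤d) = ∤-* p∤a p∤c , ∤-* p∤b p∤d

  PrimeTo-⁻¹ : ∀ {x} → PrimeTo x → PrimeTo (x ⁻¹)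
  PrimeTo-⁻¹ (p∤a , p∤b) = p∤b , p∤a

  PrimeTo-•⁺ : ∀ k {x} → PrimeTo x → PrimeTo ((+ k) • x)
  PrimeTo-•⁺ zero        x′ = PrimeTo-1/1
  PrimeTo-•⁺ (suc k) {x} x′ = PrimeTo-⊗ x ((+ k) • x) x′ (PrimeTo-•⁺ k x′)

  PrimeTo-• : ∀ i {x} → PrimeTo x → PrimeTo (i • x)
  PrimeTo-• (+ k)        x′ = PrimeTo-•⁺ k x′
  PrimeTo-• -[1+ k ] {x} x′ = PrimeTo-⁻¹ {(+ suc k) • x} (PrimeTo-•⁺ (suc k) x′)

  PrimeTo-∙ : ∀ (a : Vec ℤ n) {ρ} → VecAll.All PrimeTo ρ → PrimeTo (a ∙ ρ)
  PrimeTo-∙ []      {[]}    []        = PrimeTo-1/1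
  PrimeTo-∙ (i ∷ a) {x ∷ ρ} (x′ ∷ ρ′) = PrimeTo-⊗ (i • x) (a ∙ ρ) (PrimeTo-• i x′) (PrimeTo-∙ a ρ′)

  π : Fraction
  π = p ÷ 1

  den-•π : ∀ k → den ((+ k) • π) ≡ 1
  den-•π k = trans (den-• k π) (ℕ.^-zeroˡ k)

  -- After cross multiplication a factor p would divide the numerator of u if i > 0, and its
  -- denominator if i < 0.
  π-independent : ∀ i {u} → PrimeTo u → i • π ≃ u → i ≡ 0ℤ
  π-independent (+ zero)  _ _ = refl
  π-independent (+ suc k) {c ÷ d} (p∤c , _) (cross eq) = contradiction
    (subst (p ℕ.∣_) (trans eq (trans (cong (c ℕ.*_) (den-•π (suc k))) (ℕ.*-identityʳ c)))
      (ℕ.∣m⇒∣m*n d (ℕ.m∣m*n _))) p∤c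
  π-independent -[1+ k ] {c ÷ d} (_ , p∤d) (cross eq) = contradiction
    (subst (p ℕ.∣_) (trans (sym eq) (trans (cong (ℕ._* d) (den-•π (suc k))) (ℕ.*-identityˡ d)))
      (ℕ.∣n⇒∣m*n c (ℕ.m∣m*n _))) p∤d

  decompose : ∀ x → ∃[ i ] ∃[ u ] PrimeTo u × x ≃ i • π ⊗ u
  decompose (a ÷ b) with padic p-prime a | padic p-prime b
  ... | i , u , refl , p∤u | j , v , refl , p∤v =
    (+ i) ℤ.+ ℤ.- (+ j) , w , (p∤u , p∤v) , ≃-trans direct
      (⊗-cong {(+ i) • π ⊗ ((+ j) • π) ⁻¹} {y = w} {w}
        (ℚ⁺-Module.difference-• (+ i) (+ j)) (cross refl))
    where
    w = _÷_ u v {{ℕ.m*n≢0⇒n≢0 (p ^ i)}} {{ℕ.m*n≢0⇒n≢0 (p ^ j)}}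
    regroup : ∀ pⁱ u pʲ v → pⁱ ℕ.* u ℕ.* (1 ℕ.* pʲ ℕ.* v) ≡ pⁱ ℕ.* 1 ℕ.* u ℕ.* (pʲ ℕ.* v)
    regroup = solve-∀
    direct : _ ≃ (+ i) • π ⊗ ((+ j) • π) ⁻¹ ⊗ w
    direct = cross (subst₄ (num-• i π) (den-•π i) (num-• j π) (den-•π j))
      where
      -- The components of i • π and j • π are known only up to propositional equality, so they are
      -- abstracted before the arithmetic identity is applied.
      subst₄ : ∀ {n₁ d₁ n₂ d₂} → n₁ ≡ p ^ i → d₁ ≡ 1 → n₂ ≡ p ^ j → d₂ ≡ 1 →
               p ^ i ℕ.* u ℕ.* (d₁ ℕ.* n₂ ℕ.* v) ≡ n₁ ℕ.* d₂ ℕ.* u ℕ.* (p ^ j ℕ.* v)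
      subst₄ refl refl refl refl = regroup (p ^ i) u (p ^ j) v

  -- The valuation at p of c π + w is c, and that of m h is a multiple of m.

  π-generic : ∀ m c w → PrimeTo w → Divisible m (c • π ⊗ w) → (+ m) ℤ.∣ c
  π-generic m c w w′ d with decompose (ℚ⁺-Module.Divisible.root d)
  ... | k , u , u′ , h≈ = divides k (trans
    (ℤ.i-j≡0⇒i≡j c (+ m ℤ.* k) (π-independent (c ℤ.+ ℤ.- (+ m ℤ.* k))
      (PrimeTo-⊗ ((+ m) • u) (w ⁻¹) (PrimeTo-• (+ m) u′) (PrimeTo-⁻¹ {w} w′))
      (ℚ⁺-Module.collect-generator c (+ m) k {ℚ⁺-Module.Divisible.root d} {π} {u} {w} h≈
        (ℚ⁺-Module.Divisible.isRoot d))))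
    (ℤ.*-comm (+ m) k))

-- A prime above this sum exceeds every numerator and denominator of the tuple; these are nonzero,
-- so it divides none of them.
size : Vec Fraction n → ℕ
size []      = 0
size (x ∷ ρ) = num x ℕ.+ den x ℕ.+ size ρ

size-PrimeTo : ∀ p (pp : Prime p) (ρ : Vec Fraction n) → size ρ < p → VecAll.All (Valuation.PrimeTo p pp) ρ
size-PrimeTo p pp []            _   = []
size-PrimeTo p pp ((a ÷ b) ∷ ρ) s<p =
  ( ℕ.>⇒∤ (ℕ.≤-<-trans (ℕ.≤-trans (ℕ.m≤m+n a b) (ℕ.m≤m+n (a ℕ.+ b) (size ρ))) s<p)
  , ℕ.>⇒∤ (ℕ.≤-<-trans (ℕ.≤-trans (ℕ.m≤n+m b a) (ℕ.m≤m+n (a ℕ.+ b) (size ρ))) s<p))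
  ∷ size-PrimeTo p pp ρ (ℕ.≤-<-trans (ℕ.m≤n+m (size ρ) (a ℕ.+ b)) s<p)

ℚ⁺-ordered : GenericallyOrdered ℚ⁺
ℚ⁺-ordered = record
  { Pos         = Above1
  ; Pos-resp    = Above1-resp
  ; Pos-+       = λ {x} {y} → Above1-⊗ {x} {y}
  ; ¬Pos-0      = ℕ.<-irrefl refl
  ; trichotomy  = Above1-trichotomy
  ; somePos     = 2 ÷ 1 , ℕ.n<1+n 1
  ; halve       = λ {x} → Above1-halve {x}
  ; archimedean = λ {x} → Above1-archimedean {x}
  ; divisible?  = λ m → isPower? m
  ; generic     = λ m ρ →
      let p , p-prime , s<p = primeAbove (size ρ)
          open Valuation p p-prime
      in  π , λ c a → π-generic m c (a ∙ ρ) (PrimeTo-∙ a (size-PrimeTo p p-prime ρ s<p))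
  }

-- Rational numbers as sign and magnitude.

private
  module ℚ-+ = GroupProperties ℚ.+-0-group
  module BF = BackAndForth ℚ⁺-ordered

value⁺ : Fraction → ℚ
value⁺ (a ÷ b) = ℚ.fromℚᵘ ((+ a) ℚᵘ./ b)

toℚᵘ-value⁺ : ∀ a b .{{_ : NonZero a}} .{{_ : NonZero b}} → ℚ.toℚᵘ (value⁺ (a ÷ b)) ℚᵘ.≃ (+ a) ℚᵘ./ b
toℚᵘ-value⁺ a b = ℚ.toℚᵘ-fromℚᵘ ((+ a) ℚᵘ./ b)

value⁺-⊗ : ∀ x y → value⁺ x ℚ.* value⁺ y ≡ value⁺ (x ⊗ y)
value⁺-⊗ x@(a ÷ b@(suc _)) y@(c ÷ d@(suc _)) = ℚ.toℚᵘ-injective (begin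
  ℚ.toℚᵘ (value⁺ x ℚ.* value⁺ y)               ≈⟨ ℚ.toℚᵘ-homo-* (value⁺ x) (value⁺ y) ⟩
  ℚ.toℚᵘ (value⁺ x) ℚᵘ.* ℚ.toℚᵘ (value⁺ y)     ≈⟨ ℚᵘ.*-cong (toℚᵘ-value⁺ a b) (toℚᵘ-value⁺ c d) ⟩
  ((+ a) ℚᵘ./ b) ℚᵘ.* ((+ c) ℚᵘ./ d)           ≡⟨ cong (ℚᵘ._/ (b ℕ.* d)) (sym (ℤ.pos-* a c)) ⟩
  (+ (a ℕ.* c)) ℚᵘ./ (b ℕ.* d)                 ≈⟨ ℚᵘ.≃-sym (ℚ.toℚᵘ-fromℚᵘ ((+ (a ℕ.* c)) ℚᵘ./ (b ℕ.* d))) ⟩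
  ℚ.toℚᵘ (value⁺ (x ⊗ y))                      ∎)
  where open SetoidReasoning ℚᵘ.≃-setoid

value⁺-≤⁺ : ∀ x y → ¬ Above1 (x ⊗ y ⁻¹) → value⁺ x ℚ.≤ value⁺ y
value⁺-≤⁺ (a ÷ b@(suc _)) (c ÷ d@(suc _)) ¬y<x = ℚ.toℚᵘ-cancel-≤
  (ℚᵘ.≤-respˡ-≃ (ℚᵘ.≃-sym (toℚᵘ-value⁺ a b)) (ℚᵘ.≤-respʳ-≃ (ℚᵘ.≃-sym (toℚᵘ-value⁺ c d))
    (ℚᵘ.*≤* (subst₂ ℤ._≤_ (ℤ.pos-* a d) (ℤ.pos-* c b)
      (ℤ.+≤+ (subst (a ℕ.* d ≤_) (ℕ.*-comm b c) (ℕ.≮⇒≥ ¬y<x)))))))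

value⁺-≤⁻ : ∀ x y → value⁺ x ℚ.≤ value⁺ y → ¬ Above1 (x ⊗ y ⁻¹)
value⁺-≤⁻ (a ÷ b@(suc _)) (c ÷ d@(suc _)) x≤y
  with ℚᵘ.*≤* le ← ℚᵘ.≤-respˡ-≃ (toℚᵘ-value⁺ a b) (ℚᵘ.≤-respʳ-≃ (toℚᵘ-value⁺ c d) (ℚ.toℚᵘ-mono-≤ x≤y))
  = ℕ.≤⇒≯ (subst (a ℕ.* d ≤_) (ℕ.*-comm c b)
      (ℤ.drop‿+≤+ (subst₂ ℤ._≤_ (sym (ℤ.pos-* a d)) (sym (ℤ.pos-* c b)) le)))

value⁺>0 : ∀ x → 0ℚ ℚ.< value⁺ x
value⁺>0 (a@(suc _) ÷ b@(suc _)) = ℚ.toℚᵘ-cancel-< (ℚᵘ.<-respʳ-≃ (ℚᵘ.≃-sym (toℚᵘ-value⁺ a b))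
  (ℚᵘ.*<* (ℤ.+<+ z<s)))

data Sgn : Set where
  neg zer pos : Sgn

signs : List Sgn
signs = neg ∷ zer ∷ pos ∷ []

∈-signs : ∀ s → s ∈ signs
∈-signs neg = here refl
∈-signs zer = there (here refl)
∈-signs pos = there (there (here refl))

_*ₛ_ : Sgn → Sgn → Sgn
zer *ₛ t   = zer
pos *ₛ t   = t
neg *ₛ neg = pos
neg *ₛ zer = zer
neg *ₛ pos = neg

-- The magnitude of zero is arbitrary.

value : Sgn → Fraction → ℚ
value neg x = ℚ.- value⁺ x
value zer x = 0ℚ
value pos x = value⁺ x

value-surjective : ∀ q → ∃[ s ] ∃[ x ] value s x ≡ q
value-surjective (ℚ.mkℚ (+ zero)  d c) = zer , 1/1 , sym (ℚ.↥p≡0⇒p≡0 (ℚ.mkℚ (+ zero) d c) refl)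
value-surjective (ℚ.mkℚ (+ suc n) d c) = pos , suc n ÷ suc d , ℚ.fromℚᵘ-toℚᵘ (ℚ.mkℚ (+ suc n) d c)
value-surjective (ℚ.mkℚ -[1+ n ]  d c) = neg , suc n ÷ suc d , ℚ.fromℚᵘ-toℚᵘ (ℚ.mkℚ -[1+ n ] d c)

value-* : ∀ s t x y → value s x ℚ.* value t y ≡ value (s *ₛ t) (x ⊗ y)
value-* zer t   x y = ℚ.*-zeroˡ (value t y)
value-* pos neg x y = trans (sym (ℚ.neg-distribʳ-* (value⁺ x) (value⁺ y))) (cong ℚ.-_ (value⁺-⊗ x y))
value-* pos zer x y = ℚ.*-zeroʳ (value⁺ x)
value-* pos pos x y = value⁺-⊗ x y
value-* neg neg x y = trans (sym (ℚ.neg-distribˡ-* (value⁺ x) (ℚ.- value⁺ y)))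
  (trans (cong ℚ.-_ (value-* pos neg x y)) (ℚ-+.⁻¹-involutive _))
value-* neg zer x y = ℚ.*-zeroʳ (ℚ.- value⁺ x)
value-* neg pos x y = trans (sym (ℚ.neg-distribˡ-* (value⁺ x) (value⁺ y))) (cong ℚ.-_ (value⁺-⊗ x y))

neg<0 : ∀ x → ℚ.- value⁺ x ℚ.< 0ℚ
neg<0 x = ℚ.neg-antimono-< (value⁺>0 x)

-- Different signs settle the comparison whatever the magnitudes. Equal nonzero signs reduce it to
-- the magnitudes, in reverse order for negative numbers, hence the two implications; each runs
-- backwards because ≤ is the failure of a strict inequality.
value-≤-transport : ∀ s t {x y x′ y′} →
  (Above1 (x′ ⊗ y′ ⁻¹) → Above1 (x ⊗ y ⁻¹)) → (Above1 (y′ ⊗ x′ ⁻¹) → Above1 (y ⊗ x ⁻¹)) →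
  value s x ℚ.≤ value t y → value s x′ ℚ.≤ value t y′
value-≤-transport neg neg {x} {y} {x′} {y′} _ back x≤y = ℚ.neg-antimono-≤
  (value⁺-≤⁺ y′ x′ (value⁺-≤⁻ y x
    (subst₂ ℚ._≤_ (ℚ-+.⁻¹-involutive _) (ℚ-+.⁻¹-involutive _) (ℚ.neg-antimono-≤ x≤y)) ∘ back))
value-≤-transport neg zer {x′ = x′}      _ _ _   = ℚ.<⇒≤ (neg<0 x′)
value-≤-transport neg pos {x′ = x′} {y′} _ _ _   = ℚ.<⇒≤ (ℚ.<-trans (neg<0 x′) (value⁺>0 y′))
value-≤-transport zer neg {y = y}        _ _ 0≤y = contradiction (ℚ.<-≤-trans (neg<0 y) 0≤y) (ℚ.<-irrefl refl)
value-≤-transport zer zer                _ _ _   = ℚ.≤-refl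
value-≤-transport zer pos {y′ = y′}      _ _ _   = ℚ.<⇒≤ (value⁺>0 y′)
value-≤-transport pos neg {x} {y}        _ _ x≤y = contradiction
  (ℚ.<-≤-trans (ℚ.<-trans (neg<0 y) (value⁺>0 x)) x≤y) (ℚ.<-irrefl refl)
value-≤-transport pos zer {x}            _ _ x≤0 = contradiction (ℚ.<-≤-trans (value⁺>0 x) x≤0) (ℚ.<-irrefl refl)
value-≤-transport pos pos {x} {y} {x′} {y′} back _ x≤y = value⁺-≤⁺ x′ y′ (value⁺-≤⁻ x y x≤y ∘ back)

-- Invariance and decision of formulas.

open import Defs

environment : Vec Sgn n → Vec Fraction n → Vec ℚ n
environment = zipWith value

-- The factors 1 make this literally the bound of `Bounded-lin` for the coefficients 1 and 1.
termSize : Term n → ℕ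
termSize (var i) = 1
termSize (s · t) = 1 ℕ.* termSize s ℕ.+ 1 ℕ.* termSize t

-- A term is a monomial, hence additively an integer combination of its variables.
exponents : Term n → Vec ℤ n
exponents (var i) = ℚ⁺-Module.unit i
exponents (s · t) = ℚ⁺-Module.lin 1ℤ (exponents s) 1ℤ (exponents t)

termSign : Term n → Vec Sgn n → Sgn
termSign (var i) ss = lookup ss i
termSign (s · t) ss = termSign s ss *ₛ termSign t ss

magnitude : Term n → Vec Fraction n → Fraction
magnitude (var i) ρ = lookup ρ i
magnitude (s · t) ρ = magnitude s ρ ⊗ magnitude t ρ

⟦⟧-value : ∀ (t : Term n) ss ρ → ⟦ t ⟧ (environment ss ρ) ≡ value (termSign t ss) (magnitude t ρ)
⟦⟧-value (var i) ss ρ = Vec.lookup-zipWith value i ss ρ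
⟦⟧-value (s · t) ss ρ = trans (cong₂ ℚ._*_ (⟦⟧-value s ss ρ) (⟦⟧-value t ss ρ))
  (value-* (termSign s ss) (termSign t ss) (magnitude s ρ) (magnitude t ρ))

magnitude-exponents : ∀ (t : Term n) ρ → magnitude t ρ ≃ exponents t ∙ ρ
magnitude-exponents (var i) ρ = ℚ⁺-Module.≈-sym (ℚ⁺-Module.unit-∙ i ρ)
magnitude-exponents (s · t) ρ = ≃-trans
  (⊗-cong {magnitude s ρ} {1ℤ • (exponents s ∙ ρ)} {magnitude t ρ} {1ℤ • (exponents t ∙ ρ)}
    (≃-trans (magnitude-exponents s ρ) (ℚ⁺-Module.≈-sym (ℚ⁺-Module.1-• _)))
    (≃-trans (magnitude-exponents t ρ) (ℚ⁺-Module.≈-sym (ℚ⁺-Module.1-• _))))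
  (ℚ⁺-Module.≈-sym (ℚ⁺-Module.lin-∙ 1ℤ (exponents s) 1ℤ (exponents t) ρ))

Bounded-unit : (i : Fin n) → Bounded 1 (ℚ⁺-Module.unit i)
Bounded-unit {suc n} zero = ℕ.≤-refl ∷ BF.Bounded-zeros n
Bounded-unit (suc i)      = z≤n ∷ Bounded-unit i

Bounded-exponents : (t : Term n) → Bounded (termSize t) (exponents t)
Bounded-exponents (var i) = Bounded-unit i
Bounded-exponents (s · t) = BF.Bounded-lin {c = 1ℤ} {1ℤ} ℕ.≤-refl ℕ.≤-refl
  (Bounded-exponents s) (Bounded-exponents t)

ratio-transport : ∀ {N M} (s t : Term n) {ρ σ} →
                  1 ℕ.* termSize s ℕ.+ 1 ℕ.* termSize t ≤ N → ρ BF.[ N , M ]⟶ σ →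
                  Above1 (magnitude s ρ ⊗ magnitude t ρ ⁻¹) → Above1 (magnitude s σ ⊗ magnitude t σ ⁻¹)
ratio-transport s t {ρ} {σ} size≤N ρ⟶σ = Above1-resp (form σ) ∘
  BF._[_,_]⟶_.pos ρ⟶σ (Bounded-mono size≤N (BF.Bounded-lin {c = 1ℤ} { -1ℤ} ℕ.≤-refl ℕ.≤-refl
    (Bounded-exponents s) (Bounded-exponents t))) ∘
  Above1-resp (ℚ⁺-Module.≈-sym (form ρ))
  where
  form : ∀ ρ → ℚ⁺-Module.lin 1ℤ (exponents s) -1ℤ (exponents t) ∙ ρ ≃ magnitude s ρ ⊗ magnitude t ρ ⁻¹
  form ρ = ≃-trans (ℚ⁺-Module.lin-∙ 1ℤ (exponents s) -1ℤ (exponents t) ρ)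
    (⊗-cong {1ℤ • (exponents s ∙ ρ)} {magnitude s ρ} { -1ℤ • (exponents t ∙ ρ)} {magnitude t ρ ⁻¹}
      (≃-trans (ℚ⁺-Module.1-• _) (ℚ⁺-Module.≈-sym (magnitude-exponents s ρ)))
      (⁻¹-cong (≃-trans (ℚ⁺-Module.1-• _) (ℚ⁺-Module.≈-sym (magnitude-exponents t ρ)))))

≼-transport : ∀ {N M} (s t : Term n) ss {ρ σ} →
              1 ℕ.* termSize s ℕ.+ 1 ℕ.* termSize t ≤ N → ρ BF.[ N , M ]⟷ σ →
              environment ss ρ ⊨ (s ≼ t) → environment ss σ ⊨ (s ≼ t)
≼-transport s t ss {ρ} {σ} size≤N (_ , σ⟶ρ) =
  subst₂ ℚ._≤_ (sym (⟦⟧-value s ss σ)) (sym (⟦⟧-value t ss σ)) ∘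
  value-≤-transport (termSign s ss) (termSign t ss)
    (ratio-transport s t size≤N σ⟶ρ)
    (ratio-transport t s (ℕ.≤-trans (ℕ.≤-reflexive (ℕ.+-comm (1 ℕ.* termSize t) _)) size≤N) σ⟶ρ) ∘
  subst₂ ℚ._≤_ (⟦⟧-value s ss ρ) (⟦⟧-value t ss ρ)

-- The two properties are proved together, since deciding a quantifier over finitely many candidates
-- relies on invariance of its body. The equivalence compares magnitudes; the signs `ss` are common
-- to both sides.
record Analysis (φ : Formula n) : Set where
  field
    exponentBound modulus : ℕ
    {{modulus≢0}} : NonZero modulus
    invariant : ∀ ss {ρ σ} → ρ BF.[ exponentBound , modulus ]⟷ σ →
                environment ss ρ ⊨ φ → environment ss σ ⊨ φ
    decide    : ∀ ss ρ → Dec (environment ss ρ ⊨ φ)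

open Analysis

module _ {φ ψ : Formula n} (A : Analysis φ) (B : Analysis ψ) where

  jointBound jointModulus : ℕ
  jointBound   = exponentBound A ℕ.+ exponentBound B
  jointModulus = modulus A ℕ.* modulus B

  joint≢0 : NonZero jointModulus
  joint≢0 = ℕ.m*n≢0 (modulus A) (modulus B) {{modulus≢0 A}} {{modulus≢0 B}}

  private instance _ = joint≢0

  invariantˡ : ∀ ss {ρ σ} → ρ BF.[ jointBound , jointModulus ]⟷ σ →
               environment ss ρ ⊨ φ → environment ss σ ⊨ φ
  invariantˡ ss = invariant A ss ∘ BF.⟷-mono (ℕ.m≤m+n _ _) (ℕ.m∣m*n (modulus B))

  invariantʳ : ∀ ss {ρ σ} → ρ BF.[ jointBound , jointModulus ]⟷ σ →
               environment ss ρ ⊨ ψ → environment ss σ ⊨ ψ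
  invariantʳ ss = invariant B ss ∘ BF.⟷-mono (ℕ.m≤n+m _ (exponentBound A)) (ℕ.n∣m*n (modulus A))

module Quantifier {φ : Formula (suc n)} (A : Analysis φ) where

  private instance _ = modulus≢0 A

  open BF.Extension (exponentBound A) (modulus A)

  extended≢0 : NonZero M′
  extended≢0 = M′≢0

  -- Since ρ is equivalent to itself, any witness can be moved to a candidate of the same sign.
  exists? : ∀ ss ρ → Dec (environment ss ρ ⊨ ex φ)
  exists? ss ρ = map′
    (λ found → let s , _ , found′ = find found ; x , _ , sat = find found′ in value s x , sat)
    complete
    (Any.any? (λ s → Any.any? (λ x → decide A (s ∷ ss) (x ∷ ρ)) (candidates ρ)) signs)
    where
    complete : environment ss ρ ⊨ ex φ →
               Any (λ s → Any (λ x → environment (s ∷ ss) (x ∷ ρ) ⊨ φ) (candidates ρ)) signs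
    complete (q , sat) with value-surjective q
    ... | s , x , refl with extends ρ x BF.⟷-refl
    ... | x′ , x′∈ , x⟷x′ = lose (∈-signs s) (lose x′∈ (invariant A (s ∷ ss) x⟷x′ sat))

  forAll? : ∀ ss ρ → Dec (environment ss ρ ⊨ all φ)
  forAll? ss ρ = map′ complete
    (λ sat → All.tabulate λ {s} _ → All.tabulate λ {x} _ → sat (value s x))
    (All.all? (λ s → All.all? (λ x → decide A (s ∷ ss) (x ∷ ρ)) (candidates ρ)) signs)
    where
    complete : All (λ s → All (λ x → environment (s ∷ ss) (x ∷ ρ) ⊨ φ) (candidates ρ)) signs →
               environment ss ρ ⊨ all φ
    complete sat q with value-surjective q
    ... | s , x , refl with extends ρ x BF.⟷-refl
    ... | x′ , x′∈ , x⟷x′ = invariant A (s ∷ ss) (BF.⟷-sym x⟷x′)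
      (All.lookup (All.lookup sat (∈-signs s)) x′∈)

  ex-invariant : ∀ ss {ρ σ} → ρ BF.[ N′ , M′ ]⟷ σ → environment ss ρ ⊨ ex φ → environment ss σ ⊨ ex φ
  ex-invariant ss {σ = σ} ρ⟷σ (q , sat) with value-surjective q
  ... | s , x , refl with extends σ x ρ⟷σ
  ... | x′ , _ , x⟷x′ = value s x′ , invariant A (s ∷ ss) x⟷x′ sat

  -- The given element extends σ, so it is matched over ρ, where the hypothesis applies, and the
  -- result is carried back.
  all-invariant : ∀ ss {ρ σ} → ρ BF.[ N′ , M′ ]⟷ σ → environment ss ρ ⊨ all φ → environment ss σ ⊨ all φ
  all-invariant ss {ρ} ρ⟷σ sat q with value-surjective q
  ... | s , x , refl with extends ρ x (BF.⟷-sym ρ⟷σ)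
  ... | x′ , _ , x⟷x′ = invariant A (s ∷ ss) (BF.⟷-sym x⟷x′) (sat (value s x′))

analyse : (φ : Formula n) → Analysis φ
analyse (s ≈ t) = record
  -- Atoms involve no divisibility, which enters with the quantifiers. The exponent bound is fixed
  -- by unification with `ℕ.≤-refl`.
  { modulus   = 1
  ; invariant = λ ss ρ⟷σ eq → ℚ.≤-antisym
      (≼-transport s t ss ℕ.≤-refl ρ⟷σ (ℚ.≤-reflexive eq))
      (≼-transport t s ss (ℕ.≤-reflexive (ℕ.+-comm (1 ℕ.* termSize t) _)) ρ⟷σ (ℚ.≤-reflexive (sym eq)))
  ; decide    = λ ss ρ → _ ℚ.≟ _ }
analyse (s ≼ t) = record
  { modulus   = 1
  ; invariant = λ ss → ≼-transport s t ss ℕ.≤-refl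
  ; decide    = λ ss ρ → _ ℚ.≤? _ }
analyse (∼ φ) = let A = analyse φ in record
  { modulus≢0 = modulus≢0 A
  ; invariant = λ ss ρ⟷σ ¬φ → ¬φ ∘ invariant A ss (BF.⟷-sym ρ⟷σ)
  ; decide    = λ ss ρ → ¬? (decide A ss ρ) }
analyse (φ ∧ ψ) = let A = analyse φ ; B = analyse ψ in record
  { modulus≢0 = joint≢0 A B
  ; invariant = λ ss ρ⟷σ (p , q) → invariantˡ A B ss ρ⟷σ p , invariantʳ A B ss ρ⟷σ q
  ; decide    = λ ss ρ → decide A ss ρ ×-dec decide B ss ρ }
analyse (φ ∨ ψ) = let A = analyse φ ; B = analyse ψ in record
  { modulus≢0 = joint≢0 A B
  ; invariant = λ ss ρ⟷σ → Sum.map (invariantˡ A B ss ρ⟷σ) (invariantʳ A B ss ρ⟷σ)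
  ; decide    = λ ss ρ → decide A ss ρ ⊎-dec decide B ss ρ }
analyse (φ ⇒ ψ) = let A = analyse φ ; B = analyse ψ in record
  { modulus≢0 = joint≢0 A B
  ; invariant = λ ss ρ⟷σ f → invariantʳ A B ss ρ⟷σ ∘ f ∘ invariantˡ A B ss (BF.⟷-sym ρ⟷σ)
  ; decide    = λ ss ρ → decide A ss ρ →-dec decide B ss ρ }
analyse (all φ) = let open Quantifier (analyse φ) in record
  { modulus≢0 = extended≢0 ; invariant = all-invariant ; decide = forAll? }
analyse (ex φ) = let open Quantifier (analyse φ) in record
  { modulus≢0 = extended≢0 ; invariant = ex-invariant ; decide = exists? }

mainTheorem4 : Decidable Theory
mainTheorem4 φ = decide (analyse φ) [] []
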